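{- There exist constants $c_0>c_1>1$ and $\Delta_0$ such that for all integers $\Delta\ge\Delta_0$ and $n\ge (c_0)^{2\Delta}$ there exists a bipartite graph $H$ with vertex classes $X$ and $Y$, each of size $n$, and maximum degree at most $\Delta$, such that the following hold, where $k=\lfloor (c_0)^{\Delta}\rfloor$. 1. For all partitions $X=X_1\cup\dots\cup X_k\cup D_X$ and $Y=Y_1\cup\dots\cup Y_k\cup D_Y$ with $|X_i|,|Y_i|\le (c_1/c_0)^{\Delta}n$ for all $i$ and $|D_X|,|D_Y|\le 0.02n$, we have $$\sum_{i\ne j:\ e_H(X_i,Y_j)>0}|X_i||Y_j|>0.55(0.98n)^2.$$ 2. For all $X'\subseteq X$ and $Y'\subseteq Y$ such that $|X'|,|Y'|\ge 0.01n$, we have $e_H(X',Y')>0$.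
   Context: For sets $X',Y'$ of vertices, $e_H(X',Y')$ denotes the number of pairs in $X'\times Y'$ that are edges of $H$. Partitions are into disjoint, possibly empty, parts. The sum in item 1 is over ordered pairs $(i,j)\in\{1,\dots,k\}^2$ with $i\neq j$ and $e_H(X_i,Y_j)>0$. -}

module Defs where

open import Algebra.Definitions.RawSemiring using () renaming (_^_ to pow)
open import Data.Bool using (Bool)
open import Data.Bool.Properties using (T?)
open import Data.Fin using (Fin; _≟_)
open import Data.Fin.Subset using (Subset; _∈_; _∩_; Empty; ∣_∣)
open import Data.Fin.Subset.Properties using (_∈?_)
open import Data.Integer using (+_)
open import Data.List using (List; allFin; cartesianProduct; filter; length; map; sum)
open import Data.Nat as ℕ using (ℕ)
open import Data.Product using (∃-syntax; _×_; _,_)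
open import Data.Rational using (ℚ; 1ℚ; _<_; _/_; NonZero; >-nonZero; +-*-rawSemiring)
open import Data.Rational.Properties using (<-trans; positive⁻¹)
open import Data.Sum using (_⊎_)
open import Data.Vec using (tabulate)
open import Relation.Binary.PropositionalEquality using (_≢_)
open import Relation.Nullary.Decidable using (¬?; _×-dec_)

infixr 8 _^_

_^_ : ℚ → ℕ → ℚ
_^_ = pow +-*-rawSemiring

fromℕ : ℕ → ℚ
fromℕ m = + m / 1

nonZero : {c₀ c₁ : ℚ} → 1ℚ < c₁ → c₁ < c₀ → NonZero c₀
nonZero 1<c₁ c₁<c₀ = >-nonZero (<-trans (positive⁻¹ 1ℚ) (<-trans 1<c₁ c₁<c₀))

-- A bipartite graph whose vertex classes X and Y are two disjoint copies of
-- Fin n; the edges all run between X (first argument of adj) and Y (second).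
record BipartiteGraph (n : ℕ) : Set where
  field
    adj : Fin n → Fin n → Bool

  neighboursOfX : Fin n → Subset n
  neighboursOfX x = tabulate (λ y → adj x y)

  neighboursOfY : Fin n → Subset n
  neighboursOfY y = tabulate (λ x → adj x y)

  MaxDegree≤ : ℕ → Set
  MaxDegree≤ Δ = (∀ x → ∣ neighboursOfX x ∣ ℕ.≤ Δ) × (∀ y → ∣ neighboursOfY y ∣ ℕ.≤ Δ)

  edgesBetween : Subset n → Subset n → List (Fin n × Fin n)
  edgesBetween X′ Y′ =
    filter (λ (x , y) → x ∈? X′ ×-dec y ∈? Y′ ×-dec T? (adj x y))
           (cartesianProduct (allFin n) (allFin n))

  e : Subset n → Subset n → ℕ
  e X′ Y′ = length (edgesBetween X′ Y′)

record Partition (n k : ℕ) : Set where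
  field
    part          : Fin k → Subset n
    rest          : Subset n
    part-disjoint : ∀ i j → i ≢ j → Empty (part i ∩ part j)
    rest-disjoint : ∀ i → Empty (part i ∩ rest)
    cover         : ∀ v → (∃[ i ] v ∈ part i) ⊎ v ∈ rest

offDiagonalWeight : ∀ {n k} → BipartiteGraph n → Partition n k → Partition n k → ℕ
offDiagonalWeight {k = k} H P Q =
  sum (map (λ (i , j) → ∣ X i ∣ ℕ.* ∣ Y j ∣)
           (filter (λ (i , j) → ¬? (i ≟ j) ×-dec (e (X i) (Y j) ℕ.>? 0))
                   (cartesianProduct (allFin k) (allFin k))))
  where
  open BipartiteGraph H using (e)
  open Partition P using () renaming (part to X)
  open Partition Q using () renaming (part to Y)

{-# OPTIONS --safe #-}
module Submission where

-- Choose about Δn/40000 edges one after another, always joining two vertices of degree less than Δ;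
-- at any time all but a tiny fraction of the pairs of vertices are available.  If item 1 or item 2
-- fails for H, then all edges of H lie in one of few "bad" sets of pairs: a union of blocks
-- Xᵢ × Yⱼ of density at most 0.58, of which there are at most (k+1)^(2n) 2^((k+1)²), or the
-- complement of a rectangle X′ × Y′, of density at most 0.9999, of which there are 4ⁿ.  As k² ≤ n and
-- c₀ is close to 1, random choices leave fewer than one bad set containing all of the edges on average,
-- and the method of conditional expectations finds choices that leave none.

open import Data.Bool using (Bool; true; false; T; not; if_then_else_; _∧_; _∨_)
open import Data.Bool.ListAction using (any)
open import Data.Bool.Properties using (T?; T-∧; T-≡)
open import Data.Fin using (Fin; zero; suc; _≟_)
open import Data.Fin.Subset using (Subset; ∣_∣) renaming (_∈_ to _∈ₛ_)
open import Data.Fin.Subset.Properties using (_∈?_)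
open import Data.List using (List; []; _∷_; _++_; map; length; filter; filterᵇ; cartesianProduct; cartesianProductWith; allFin)
open import Data.List.Membership.Propositional using (_∈_; lose)
open import Data.List.Membership.Propositional.Properties using
  (∈-filter⁺; ∈-filter⁻; ∈-cartesianProduct⁺; ∈-cartesianProductWith⁺; ∈-allFin; ∈-length; ∈-++⁺ˡ; ∈-++⁺ʳ; ∈-map⁺)
open import Data.List.Properties using (map-tabulate; length-map; length-tabulate; length-++; length-filter)
open import Data.List.Relation.Binary.Subset.Propositional using (_⊆_)
open import Data.List.Relation.Unary.All using (All; []; _∷_)
open import Data.List.Relation.Unary.All.Properties using (all-filter)
open import Data.List.Relation.Unary.Any using (here; there)
open import Data.List.Relation.Unary.Any.Properties using (any⁺)
open import Data.Nat as ℕ using (ℕ; zero; suc)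
import Data.Nat.DivMod as ℕ
open import Data.Nat.ListAction using (sum)
import Data.Nat.Properties as ℕ
open import Data.Nat.Tactic.RingSolver using (solve-∀)
open import Data.Product using (Σ-syntax; ∃-syntax; _×_; _,_; proj₁; proj₂)
open import Data.Sum using (_⊎_; inj₁; inj₂)
open import Data.Vec using (Vec; []; _∷_; lookup; tabulate)
open import Data.Vec.Properties using (lookup∘tabulate; []=⇒lookup; lookup⇒[]=)
open import Function using (_∘_; id; Equivalence)
open import Relation.Binary.PropositionalEquality using (_≡_; refl; sym; trans; cong; cong₂; subst; subst₂; module ≡-Reasoning)
open import Relation.Nullary using (Dec; yes; no; does; ¬_; contradiction)
open import Relation.Nullary.Decidable using (_×-dec_; ¬?; dec-true)
open import Relation.Unary using (Decidable)

-- Which blocks carry edges depends on `H`, while the family of bad sets has to be fixed before any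
-- edge is chosen. Hence every 0/1 table is listed together with every labelling of both classes,
-- and this large number must be beaten by the M-th power of the density, where M = n⌊Δ/40000⌋. The
-- budget is split in two. Write d = ⌊Δ/40000⌋. For block sets a factor 9/10 of the density is set
-- aside: (9/10)ᵈ for each of n vertices pays for two labels, since k² ≤ (10/9)ᵈ, and this is what
-- forces `c₀` so close to 1. After that both families cost at most 64ⁿ, which (19998/19999)ⁿᵈ
-- defeats once Δ is large. Complements of rectangles are almost full, so only the second factor is
-- available for them, but there are few of them. Densities must be taken relative to the available
-- pairs. The loss there has to stay below the 1/10000 gained from a rectangle; spending only
-- 1/40000 of the degree capacity keeps it below 1/20000, half of that gain. A pair may be chosen
-- repeatedly. This is harmless, as forgetting multiplicities only lowers degrees, and no pair has
-- to be removed from the available ones.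

module Combinatorics where

  open import Defs using (BipartiteGraph; Partition; offDiagonalWeight)
  open import Data.Nat using
    (_+_; _*_; _∸_; _^_; _/_; _%_; _≤_; _<_; _>_; _<ᵇ_; _≤?_; _<?_; _>?_; z≤n; s≤s; NonZero; >-nonZero⁻¹)
  open import Data.Nat.DivMod using (m≡m%n+[m/n]*n; m%n≤n; m/n*n≤m; m*n/n≡m; /-monoˡ-≤; m≥n⇒m/n>0)
  open import Data.Nat.Properties hiding (_≟_; _≤?_; _<?_; _>?_)

  private variable
    A B C : Set
    n k : ℕ

  -- Finite sums over lists and indicators

  𝟙 : Bool → ℕ
  𝟙 b = if b then 1 else 0

  ∑ : List A → (A → ℕ) → ℕ
  ∑ xs f = sum (map f xs)

  ∑-mono : (xs : List A) {f g : A → ℕ} → (∀ x → f x ≤ g x) → ∑ xs f ≤ ∑ xs g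
  ∑-mono []       f≤g = z≤n
  ∑-mono (x ∷ xs) f≤g = +-mono-≤ (f≤g x) (∑-mono xs f≤g)

  ∑-cong : (xs : List A) {f g : A → ℕ} → (∀ x → f x ≡ g x) → ∑ xs f ≡ ∑ xs g
  ∑-cong []       f≡g = refl
  ∑-cong (x ∷ xs) f≡g = cong₂ _+_ (f≡g x) (∑-cong xs f≡g)

  ∑-+ : (xs : List A) (f g : A → ℕ) → ∑ xs (λ x → f x + g x) ≡ ∑ xs f + ∑ xs g
  ∑-+ []       f g = refl
  ∑-+ (x ∷ xs) f g = trans (cong (f x + g x +_) (∑-+ xs f g)) (interchange (f x) (g x) _ _)
    where
    interchange : ∀ a b c d → a + b + (c + d) ≡ a + c + (b + d)
    interchange = solve-∀

  ∑-*ˡ : (xs : List A) (c : ℕ) (f : A → ℕ) → ∑ xs (λ x → c * f x) ≡ c * ∑ xs f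
  ∑-*ˡ []       c f = sym (*-zeroʳ c)
  ∑-*ˡ (x ∷ xs) c f = trans (cong (c * f x +_) (∑-*ˡ xs c f)) (sym (*-distribˡ-+ c (f x) _))

  ∑-*ʳ : (xs : List A) (f : A → ℕ) (c : ℕ) → ∑ xs (λ x → f x * c) ≡ ∑ xs f * c
  ∑-*ʳ []       f c = refl
  ∑-*ʳ (x ∷ xs) f c = trans (cong (f x * c +_) (∑-*ʳ xs f c)) (sym (*-distribʳ-+ c (f x) _))

  ∑-const : (xs : List A) (c : ℕ) → ∑ xs (λ _ → c) ≡ length xs * c
  ∑-const []       c = refl
  ∑-const (x ∷ xs) c = cong (c +_) (∑-const xs c)

  ∑-swap : (xs : List A) (ys : List B) (f : A → B → ℕ) →
           ∑ xs (λ x → ∑ ys (f x)) ≡ ∑ ys (λ y → ∑ xs (λ x → f x y))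
  ∑-swap []       ys f = sym (trans (∑-const ys 0) (*-zeroʳ (length ys)))
  ∑-swap (x ∷ xs) ys f = trans (cong (∑ ys (f x) +_) (∑-swap xs ys f))
                               (sym (∑-+ ys (f x) (λ y → ∑ xs (λ x → f x y))))

  ∑-++ : (xs ys : List A) (f : A → ℕ) → ∑ (xs ++ ys) f ≡ ∑ xs f + ∑ ys f
  ∑-++ []       ys f = refl
  ∑-++ (x ∷ xs) ys f = trans (cong (f x +_) (∑-++ xs ys f)) (sym (+-assoc (f x) _ _))

  ∑-map : (g : A → B) (xs : List A) (f : B → ℕ) → ∑ (map g xs) f ≡ ∑ xs (f ∘ g)
  ∑-map g []       f = refl
  ∑-map g (x ∷ xs) f = cong (f (g x) +_) (∑-map g xs f)

  ∑-cartesianProduct : (xs : List A) (ys : List B) (f : A × B → ℕ) →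
                       ∑ (cartesianProduct xs ys) f ≡ ∑ xs (λ x → ∑ ys (λ y → f (x , y)))
  ∑-cartesianProduct []       ys f = refl
  ∑-cartesianProduct (x ∷ xs) ys f =
    trans (∑-++ (map (x ,_) ys) (cartesianProduct xs ys) f)
          (cong₂ _+_ (∑-map (x ,_) ys f) (∑-cartesianProduct xs ys f))

  ∑-product : (xs : List A) (ys : List B) (f : A → ℕ) (g : B → ℕ) →
              ∑ xs (λ x → ∑ ys (λ y → f x * g y)) ≡ ∑ xs f * ∑ ys g
  ∑-product xs ys f g = trans (∑-cong xs (λ x → ∑-*ˡ ys (f x) g)) (∑-*ʳ xs f (∑ ys g))

  ∑-filter : {P : A → Set} (P? : Decidable P) (xs : List A) (f : A → ℕ) →
             ∑ (filter P? xs) f ≡ ∑ xs (λ x → 𝟙 (does (P? x)) * f x)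
  ∑-filter P? []       f = refl
  ∑-filter P? (x ∷ xs) f with does (P? x)
  ... | false = ∑-filter P? xs f
  ... | true  = cong₂ _+_ (sym (*-identityˡ (f x))) (∑-filter P? xs f)

  ∑-∈ : {x : A} {xs : List A} (f : A → ℕ) → x ∈ xs → f x ≤ ∑ xs f
  ∑-∈ f (here refl)         = m≤m+n _ _
  ∑-∈ f (there {x = y} x∈xs) = ≤-trans (∑-∈ f x∈xs) (m≤n+m _ (f y))

  ∑-length : (xs : List A) → ∑ xs (λ _ → 1) ≡ length xs
  ∑-length xs = trans (∑-const xs 1) (*-identityʳ (length xs))

  𝟙≤1 : ∀ b → 𝟙 b ≤ 1
  𝟙≤1 false = z≤n
  𝟙≤1 true  = ≤-refl

  𝟙-∧ : ∀ a b → 𝟙 (a ∧ b) ≡ 𝟙 a * 𝟙 b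
  𝟙-∧ false b = refl
  𝟙-∧ true  b = sym (*-identityˡ (𝟙 b))

  -- Choosing pairs by conditional expectations

  -- The strict inequality also excludes the empty list, so a greedy step needs no separate proof
  -- that some pair is available.
  below-average : (xs : List A) (f : A → ℕ) (c : ℕ) → ∑ xs f < length xs * c →
                  Σ[ x ∈ A ] (x ∈ xs × f x < c)
  below-average (x ∷ xs) f c ∑<c with f x <? c
  ... | yes fx<c = x , here refl , fx<c
  ... | no  fx≮c = let y , y∈xs , fy<c = below-average xs f c ∑′<c in y , there y∈xs , fy<c
    where
    ∑′<c : ∑ xs f < length xs * c
    ∑′<c = +-cancelˡ-< c _ _ (≤-<-trans (+-monoˡ-≤ _ (≮⇒≥ fx≮c)) ∑<c)

  -- Method of conditional expectations: if the elements of E were chosen independently and uniformly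
  -- from a set of size U, the quantity ∑ L (λ S → size S ^ r) / U ^ r would bound the expected
  -- number of members of L containing all of the r elements still to be chosen.
  module Greedy {V : Set} (vs : List V) (Good : List V → Set) (ok : List V → V → Bool) (U M : ℕ)
    (extend : ∀ {E v} → Good E → T (ok E v) → Good (v ∷ E))
    (room : ∀ {E} → Good E → length E ≤ M → U ≤ length (filterᵇ (ok E) vs))
    where

    size : (V → Bool) → ℕ
    size S = ∑ vs (𝟙 ∘ S)

    potential : ℕ → List (V → Bool) → ℕ
    potential r L = ∑ L (λ S → size S ^ r)

    -- Exchanging the sums, each `S` is counted once for every admissible `v` in it, hence at most
    -- `size S` times; this supplies the missing factor of the power.
    averaging : ∀ r L E →
                ∑ (filterᵇ (ok E) vs) (λ v → potential r (filterᵇ (λ S → S v) L)) ≤ potential (suc r) L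
    averaging r L E = begin
      ∑ F (λ v → potential r (filterᵇ (λ S → S v) L))   ≡⟨ ∑-cong F (λ v → ∑-filter (λ S → T? (S v)) L w) ⟩
      ∑ F (λ v → ∑ L (λ S → 𝟙 (S v) * w S))             ≡⟨ ∑-swap F L (λ v S → 𝟙 (S v) * w S) ⟩
      ∑ L (λ S → ∑ F (λ v → 𝟙 (S v) * w S))             ≤⟨ ∑-mono L fewer ⟩
      ∑ L (λ S → ∑ vs (λ v → 𝟙 (S v) * w S))            ≡⟨ ∑-cong L (λ S → ∑-*ʳ vs (𝟙 ∘ S) (w S)) ⟩
      potential (suc r) L                               ∎
      where
      open ≤-Reasoning
      F = filterᵇ (ok E) vs
      w : (V → Bool) → ℕ
      w S = size S ^ r
      fewer : ∀ S → ∑ F (λ v → 𝟙 (S v) * w S) ≤ ∑ vs (λ v → 𝟙 (S v) * w S)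
      fewer S = begin
        ∑ F (λ v → 𝟙 (S v) * w S)                       ≡⟨ ∑-filter (T? ∘ ok E) vs _ ⟩
        ∑ vs (λ v → 𝟙 (ok E v) * (𝟙 (S v) * w S))       ≤⟨ ∑-mono vs (λ v → *-monoˡ-≤ _ (𝟙≤1 (ok E v))) ⟩
        ∑ vs (λ v → 1 * (𝟙 (S v) * w S))                ≡⟨ ∑-cong vs (λ v → *-identityˡ _) ⟩
        ∑ vs (λ v → 𝟙 (S v) * w S)                      ∎

    Escapes : List V → (V → Bool) → Set
    Escapes E S = Σ[ v ∈ V ] (v ∈ E × S v ≡ false)

    -- Induction on `r`, with `L` the sets not yet escaped. Some admissible `v` does at least as
    -- well as the average, and the sets missing `v` are dropped. They stay escaped because the
    -- final list extends the current one, which is why `E ⊆ E′` is part of the conclusion.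
    escape-all : ∀ r E L → Good E → length E + r ≤ M → potential r L < U ^ r →
                 Σ[ E′ ∈ List V ] (Good E′ × E ⊆ E′ × (∀ {S} → S ∈ L → Escapes E′ S))
    escape-all zero    E []      good _  _ = E , good , id , λ ()
    -- With no choices left every remaining set contributes 1, so a potential below 1 means that
    -- none remains.
    escape-all zero    E (_ ∷ _) good _  (s≤s ())
    escape-all (suc r) E L       good |E|+r<M pot< =
      let v , v∈F , pot′< = below-average F (λ v → potential r (filterᵇ (λ S → S v) L)) (U ^ r) sum<
          E′ , good′ , vE⊆E′ , escapes = escape-all r (v ∷ E) (filterᵇ (λ S → S v) L)
            (extend good (proj₂ (∈-filter⁻ (T? ∘ ok E) {xs = vs} v∈F)))
            (≤-trans (≤-reflexive (sym (+-suc _ r))) |E|+r<M) pot′<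
      in E′ , good′ , vE⊆E′ ∘ there , λ {S} → by-choice-of v vE⊆E′ escapes S
      where
      F = filterᵇ (ok E) vs
      sum< : ∑ F (λ v → potential r (filterᵇ (λ S → S v) L)) < length F * U ^ r
      sum< = begin-strict
        ∑ F (λ v → potential r (filterᵇ (λ S → S v) L))  ≤⟨ averaging r L E ⟩
        potential (suc r) L                              <⟨ pot< ⟩
        U * U ^ r  ≤⟨ *-monoˡ-≤ (U ^ r) (room good (≤-trans (m≤m+n _ (suc r)) |E|+r<M)) ⟩
        length F * U ^ r                                 ∎
        where open ≤-Reasoning
      by-choice-of : ∀ v {E′} → (v ∷ E) ⊆ E′ → (∀ {S} → S ∈ filterᵇ (λ S → S v) L → Escapes E′ S) →
                     ∀ S → S ∈ L → Escapes E′ S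
      by-choice-of v vE⊆E′ escapes S S∈L with S v in eq
      ... | false = v , vE⊆E′ (here refl) , eq
      ... | true  = escapes (∈-filter⁺ (λ S → T? (S v)) S∈L (subst T (sym eq) _))

  -- Counting subsets, degrees and saturated vertices

  ∑-allFin-suc : (f : Fin (suc n) → ℕ) → ∑ (allFin (suc n)) f ≡ f zero + ∑ (allFin n) (f ∘ suc)
  ∑-allFin-suc f =
    cong (λ xs → f zero + sum xs) (trans (map-tabulate suc f) (sym (map-tabulate id (f ∘ suc))))

  ∑-𝟙-≟ : (i : Fin n) → ∑ (allFin n) (λ x → 𝟙 (does (i ≟ x))) ≡ 1
  ∑-𝟙-≟ {suc n} zero    = 
    trans (∑-allFin-suc {n} (λ x → 𝟙 (does (zero ≟ x)))) (cong suc (trans (∑-const (allFin n) 0) (*-zeroʳ (length (allFin n)))))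
  ∑-𝟙-≟ {suc n} (suc i) = trans (∑-allFin-suc {n} (λ x → 𝟙 (does (suc i ≟ x)))) (∑-𝟙-≟ i)

  ∣∣≡∑ : (p : Subset n) → ∣ p ∣ ≡ ∑ (allFin n) (𝟙 ∘ lookup p)
  ∣∣≡∑             []          = refl
  ∣∣≡∑ {n = suc n} (true ∷ p)  = trans (cong suc (∣∣≡∑ p)) (sym (∑-allFin-suc {n} (𝟙 ∘ lookup (true ∷ p))))
  ∣∣≡∑ {n = suc n} (false ∷ p) = trans (∣∣≡∑ p) (sym (∑-allFin-suc {n} (𝟙 ∘ lookup (false ∷ p))))

  𝟙-any : (p : A → Bool) (xs : List A) → 𝟙 (any p xs) ≤ ∑ xs (𝟙 ∘ p)
  𝟙-any p []       = z≤n
  𝟙-any p (x ∷ xs) with p x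
  ... | true  = s≤s z≤n
  ... | false = 𝟙-any p xs

  Edge : ℕ → Set
  Edge n = Fin n × Fin n

  edges : ∀ n → List (Edge n)
  edges n = cartesianProduct (allFin n) (allFin n)

  deg : (Edge n → Fin n) → List (Edge n) → Fin n → ℕ
  deg π E x = ∑ E (λ v → 𝟙 (does (π v ≟ x)))

  ∑-deg : (π : Edge n → Fin n) (E : List (Edge n)) → ∑ (allFin n) (deg π E) ≡ length E
  ∑-deg {n} π E = begin
    ∑ (allFin n) (deg π E)                                 ≡⟨ ∑-swap (allFin n) E _ ⟩
    ∑ E (λ v → ∑ (allFin n) (λ x → 𝟙 (does (π v ≟ x))))    ≡⟨ ∑-cong E (λ v → ∑-𝟙-≟ (π v)) ⟩
    ∑ E (λ _ → 1)                                          ≡⟨ ∑-length E ⟩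
    length E                                               ∎
    where open ≡-Reasoning

  ∑-allFin-const : ∀ n c → ∑ (allFin n) (λ _ → c) ≡ n * c
  ∑-allFin-const n c = trans (∑-const (allFin n) c) (cong (_* c) {length (allFin n)} {n} (length-tabulate id))

  unsaturated : ℕ → (Edge n → Fin n) → List (Edge n) → ℕ
  unsaturated {n} Δ π E = ∑ (allFin n) (λ x → 𝟙 (deg π E x <ᵇ Δ))

  -- A saturated vertex contributes at least Δ to the degree sum, and an unsaturated one is paid for
  -- by its indicator. Few pairs therefore leave few saturated vertices.
  ∑-deg-unsaturated : ∀ Δ (π : Edge n → Fin n) E → n * Δ ≤ length E + unsaturated Δ π E * Δ
  ∑-deg-unsaturated {n} Δ π E = begin
    n * Δ                                                   ≡⟨ sym (∑-allFin-const n Δ) ⟩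
    ∑ (allFin n) (λ _ → Δ)                                  ≤⟨ ∑-mono (allFin n) (λ x → split (deg π E x)) ⟩
    ∑ (allFin n) (λ x → deg π E x + u x * Δ)                ≡⟨ ∑-+ (allFin n) (deg π E) (λ x → u x * Δ) ⟩
    ∑ (allFin n) (deg π E) + ∑ (allFin n) (λ x → u x * Δ)   ≡⟨ cong₂ _+_ (∑-deg π E) (∑-*ʳ (allFin n) u Δ) ⟩
    length E + unsaturated Δ π E * Δ                        ∎
    where
    open ≤-Reasoning
    u : Fin n → ℕ
    u x = 𝟙 (deg π E x <ᵇ Δ)
    split : ∀ m → Δ ≤ m + 𝟙 (m <ᵇ Δ) * Δ
    split m with m <ᵇ Δ in eq
    ... | true  = ≤-trans (≤-reflexive (sym (*-identityˡ Δ))) (m≤n+m _ m)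
    ... | false = ≤-trans (≮⇒≥ (λ m<Δ → subst T eq (<⇒<ᵇ m<Δ))) (m≤m+n m 0)

  -- From lists of pairs to bipartite graphs

  graph : List (Edge n) → BipartiteGraph n
  graph E = record { adj = λ x y → any (λ v → does (proj₁ v ≟ x) ∧ does (proj₂ v ≟ y)) E }

  module _ (E : List (Edge n)) where
    open BipartiteGraph (graph E)

    adj-∈ : ∀ {x y} → (x , y) ∈ E → T (adj x y)
    adj-∈ {x} {y} xy∈E = any⁺ _ (lose xy∈E
      (Equivalence.from T-∧ (Equivalence.from T-≡ (dec-true (x ≟ x) refl) , Equivalence.from T-≡ (dec-true (y ≟ y) refl))))

    𝟙-adj : ∀ x y → 𝟙 (adj x y) ≤ ∑ E (λ v → 𝟙 (does (proj₁ v ≟ x)) * 𝟙 (does (proj₂ v ≟ y)))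
    𝟙-adj x y = ≤-trans (𝟙-any _ E) (≤-reflexive (∑-cong E (λ v → 𝟙-∧ (does (proj₁ v ≟ x)) _)))

    -- Each entry of `E` has exactly one endpoint under `ρ`, so summing over all `y` counts every
    -- entry at `x` once. Keeping both projections abstract lets one argument serve both classes.
    ∣tabulate∣≤deg : (π ρ : Edge n → Fin n) (x : Fin n) (p : Fin n → Bool) →
                     (∀ y → 𝟙 (p y) ≤ ∑ E (λ v → 𝟙 (does (π v ≟ x)) * 𝟙 (does (ρ v ≟ y)))) →
                     ∣ tabulate p ∣ ≤ deg π E x
    ∣tabulate∣≤deg π ρ x p p≤ = begin
      ∣ tabulate p ∣                                            ≡⟨ ∣∣≡∑ (tabulate p) ⟩
      ∑ (allFin n) (𝟙 ∘ lookup (tabulate p))                    ≡⟨ ∑-cong (allFin n) (cong 𝟙 ∘ lookup∘tabulate p) ⟩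
      ∑ (allFin n) (𝟙 ∘ p)                                      ≤⟨ ∑-mono (allFin n) p≤ ⟩
      ∑ (allFin n) (λ y → ∑ E (λ v → a v * b v y))              ≡⟨ ∑-swap (allFin n) E (λ y v → a v * b v y) ⟩
      ∑ E (λ v → ∑ (allFin n) (λ y → a v * b v y))              ≡⟨ ∑-cong E (λ v → ∑-*ˡ (allFin n) (a v) (b v)) ⟩
      ∑ E (λ v → a v * ∑ (allFin n) (b v))                      ≡⟨ ∑-cong E (λ v → cong (a v *_) (∑-𝟙-≟ (ρ v))) ⟩
      ∑ E (λ v → a v * 1)                                       ≡⟨ ∑-cong E (λ v → *-identityʳ (a v)) ⟩
      deg π E x                                                 ∎
      where
      open ≤-Reasoning
      a : Edge n → ℕ
      a v = 𝟙 (does (π v ≟ x))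
      b : Edge n → Fin n → ℕ
      b v y = 𝟙 (does (ρ v ≟ y))

    neighboursOfX≤deg : ∀ x → ∣ neighboursOfX x ∣ ≤ deg proj₁ E x
    neighboursOfX≤deg x = ∣tabulate∣≤deg proj₁ proj₂ x (adj x) (𝟙-adj x)

    neighboursOfY≤deg : ∀ y → ∣ neighboursOfY y ∣ ≤ deg proj₂ E y
    neighboursOfY≤deg y = ∣tabulate∣≤deg proj₂ proj₁ y (λ x → adj x y) (λ x →
      ≤-trans (𝟙-adj x y) (≤-reflexive (∑-cong E (λ v → *-comm (𝟙 (does (proj₁ v ≟ x))) _))))

  e>0 : (H : BipartiteGraph n) (X Y : Subset n) {x y : Fin n} →
        x ∈ₛ X → y ∈ₛ Y → T (BipartiteGraph.adj H x y) → BipartiteGraph.e H X Y > 0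
  e>0 H X Y {x} {y} x∈X y∈Y xy = ∈-length (∈-filter⁺
    (λ (x , y) → x ∈? X ×-dec y ∈? Y ×-dec T? (BipartiteGraph.adj H x y))
    (∈-cartesianProduct⁺ (∈-allFin x) (∈-allFin y)) (x∈X , y∈Y , xy))

  -- Enumeration of vectors

  length-cartesianProductWith : (f : A → B → C) (xs : List A) (ys : List B) →
                                length (cartesianProductWith f xs ys) ≡ length xs * length ys
  length-cartesianProductWith f []       ys = refl
  length-cartesianProductWith f (x ∷ xs) ys =
    trans (length-++ (map (f x) ys)) (cong₂ _+_ (length-map (f x) ys) (length-cartesianProductWith f xs ys))

  allVecs : List A → ∀ n → List (Vec A n)
  allVecs xs zero    = [] ∷ []
  allVecs xs (suc n) = cartesianProductWith _∷_ xs (allVecs xs n)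

  length-allVecs : (xs : List A) → ∀ n → length (allVecs xs n) ≡ length xs ^ n
  length-allVecs xs zero    = refl
  length-allVecs xs (suc n) =
    trans (length-cartesianProductWith _∷_ xs (allVecs xs n)) (cong (length xs *_) (length-allVecs xs n))

  ∈-allVecs : {xs : List A} → (∀ x → x ∈ xs) → (v : Vec A n) → v ∈ allVecs xs n
  ∈-allVecs ∈xs []      = here refl
  ∈-allVecs ∈xs (x ∷ v) = ∈-cartesianProductWith⁺ _∷_ (∈xs x) (∈-allVecs ∈xs v)

  ∣_∣ₑ : (Edge n → Bool) → ℕ
  ∣ S ∣ₑ = ∑ (edges _) (𝟙 ∘ S)

  module _ (n Δ M u : ℕ) (many-unsaturated : ∀ w → n * Δ ≤ M + w * Δ → u ≤ w) where

    private
      Good : List (Edge n) → Set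
      Good E = (∀ x → deg proj₁ E x ≤ Δ) × (∀ y → deg proj₂ E y ≤ Δ)

      ok : List (Edge n) → Edge n → Bool
      ok E (x , y) = (deg proj₁ E x <ᵇ Δ) ∧ (deg proj₂ E y <ᵇ Δ)

      deg-∷ : ∀ (π : Edge n → Fin n) E v → (∀ x → deg π E x ≤ Δ) → T (deg π E (π v) <ᵇ Δ) →
              ∀ x → deg π (v ∷ E) x ≤ Δ
      deg-∷ π E v deg≤Δ <Δ x with π v ≟ x
      ... | yes refl = <ᵇ⇒< (deg π E (π v)) Δ <Δ
      ... | no  _    = deg≤Δ x

      extend : ∀ {E v} → Good E → T (ok E v) → Good (v ∷ E)
      extend {E} {v} (X , Y) okv =
        let okX , okY = Equivalence.to (T-∧ {deg proj₁ E (proj₁ v) <ᵇ Δ}) okv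
        in deg-∷ proj₁ E v X okX , deg-∷ proj₂ E v Y okY

      u≤unsaturated : ∀ (π : Edge n → Fin n) E → length E ≤ M → u ≤ unsaturated Δ π E
      u≤unsaturated π E |E|≤M = many-unsaturated (unsaturated Δ π E) (≤-trans (∑-deg-unsaturated Δ π E) (+-monoˡ-≤ _ |E|≤M))

      -- Admissibility depends on degrees alone, so the admissible pairs form a full rectangle of
      -- unsaturated vertices, including pairs already chosen.
      room : ∀ {E} → Good E → length E ≤ M → u * u ≤ length (filterᵇ (ok E) (edges n))
      room {E} _ |E|≤M = begin
        u * u
          ≤⟨ *-mono-≤ (u≤unsaturated proj₁ E |E|≤M) (u≤unsaturated proj₂ E |E|≤M) ⟩
        unsaturated Δ proj₁ E * unsaturated Δ proj₂ E        ≡⟨ sym (∑-product (allFin n) (allFin n) _ _) ⟩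
        ∑ (allFin n) (λ x → ∑ (allFin n) (λ y → 𝟙 (deg proj₁ E x <ᵇ Δ) * 𝟙 (deg proj₂ E y <ᵇ Δ)))
          ≡⟨ ∑-cong (allFin n) (λ x → ∑-cong (allFin n) (λ y → sym (trans (*-identityʳ _) (𝟙-∧ (deg proj₁ E x <ᵇ Δ) _)))) ⟩
        ∑ (allFin n) (λ x → ∑ (allFin n) (λ y → 𝟙 (ok E (x , y)) * 1))
          ≡⟨ sym (∑-cartesianProduct (allFin n) (allFin n) _) ⟩
        ∑ (edges n) (λ v → 𝟙 (ok E v) * 1)                   ≡⟨ sym (∑-filter (T? ∘ ok E) (edges n) (λ _ → 1)) ⟩
        ∑ (filterᵇ (ok E) (edges n)) (λ _ → 1)               ≡⟨ ∑-length (filterᵇ (ok E) (edges n)) ⟩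
        length (filterᵇ (ok E) (edges n))                    ∎
        where open ≤-Reasoning

    escaping-graph : (L : List (Edge n → Bool)) → ∑ L (λ S → ∣ S ∣ₑ ^ M) < (u * u) ^ M →
      Σ[ H ∈ BipartiteGraph n ] (BipartiteGraph.MaxDegree≤ H Δ ×
        (∀ {S} → S ∈ L → Σ[ x ∈ Fin n ] Σ[ y ∈ Fin n ] (T (BipartiteGraph.adj H x y) × S (x , y) ≡ false)))
    escaping-graph L small =
      let E , (X , Y) , _ , escapes = escape-all M [] L ((λ _ → z≤n) , (λ _ → z≤n)) ≤-refl small
      in graph E
       , ((λ x → ≤-trans (neighboursOfX≤deg E x) (X x)) , (λ y → ≤-trans (neighboursOfY≤deg E y) (Y y)))
       , λ S∈L → let (x , y) , xy∈E , Sxy≡false = escapes S∈L in x , y , adj-∈ E xy∈E , Sxy≡false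
      where open Greedy (edges n) Good ok (u * u) M (λ {E} {v} → extend {E} {v}) (λ {E} → room {E})

  -- Estimates for powers and for the number of bad sets

  ^-distribʳ-* : ∀ a b n → (a * b) ^ n ≡ a ^ n * b ^ n
  ^-distribʳ-* a b zero    = refl
  ^-distribʳ-* a b (suc n) = trans (cong (a * b *_) (^-distribʳ-* a b n)) (interchange a b (a ^ n) (b ^ n))
    where
    interchange : ∀ a b c d → a * b * (c * d) ≡ a * c * (b * d)
    interchange = solve-∀

  -- (p / (1 + p)) ^ j ≥ 1 - j / (1 + p)
  bernoulli⁻ : ∀ p j → suc p ^ j * suc p ≤ p ^ j * suc p + j * suc p ^ j
  bernoulli⁻ p zero    = m≤m+n _ 0
  bernoulli⁻ p (suc j) = begin
    suc p * suc p ^ j * suc p                                ≡⟨ *-assoc (suc p) (suc p ^ j) (suc p) ⟩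
    suc p * (suc p ^ j * suc p)                              ≤⟨ *-monoʳ-≤ (suc p) (bernoulli⁻ p j) ⟩
    suc p * (p ^ j * suc p + j * suc p ^ j)                  ≡⟨ expand p (p ^ j) j (suc p ^ j) ⟩
    p * p ^ j * suc p + (suc p * p ^ j + j * (suc p * suc p ^ j))
      ≤⟨ +-monoʳ-≤ (p * p ^ j * suc p) (+-monoˡ-≤ _ (*-monoʳ-≤ (suc p) (^-monoˡ-≤ j (n≤1+n p)))) ⟩
    p ^ suc j * suc p + suc j * suc p ^ suc j                ∎
    where
    open ≤-Reasoning
    expand : ∀ p a j b → suc p * (a * suc p + j * b) ≡ p * a * suc p + (suc p * a + j * (suc p * b))
    expand = solve-∀

  -- (1 + 1 / f) ^ d ≥ 1 + d / f
  bernoulli⁺ : ∀ f d → f ^ d * (f + d) ≤ f * suc f ^ d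
  bernoulli⁺ f zero    = ≤-reflexive (trans (*-identityˡ _) (trans (+-identityʳ f) (sym (*-identityʳ f))))
  bernoulli⁺ f (suc d) = begin
    f * f ^ d * (f + suc d)                  ≡⟨ expand f (f ^ d) d ⟩
    f * (f ^ d * (f + d) + f ^ d)            ≤⟨ *-monoʳ-≤ f (+-mono-≤ (bernoulli⁺ f d) (^-monoˡ-≤ d (n≤1+n f))) ⟩
    f * (f * suc f ^ d + suc f ^ d)          ≡⟨ cong (f *_) (+-comm (f * suc f ^ d) _) ⟩
    f * suc f ^ suc d                        ∎
    where
    open ≤-Reasoning
    expand : ∀ f a d → f * a * (f + suc d) ≡ f * (a * (f + d) + a)
    expand = solve-∀

  -- By `bernoulli⁺`, (1 + 1/f)ᵈ ≥ 1 + d/f ≥ 1 + c. This serves both to make the potential small and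
  -- to make (c₁/c₀)^Δ at most 1/100.
  *-^-<-suc-^ : ∀ c f d .{{_ : NonZero f}} → c * f ≤ d → c * f ^ d < suc f ^ d
  *-^-<-suc-^ c f d cf≤d = *-cancelˡ-≤ f (begin
    f * suc (c * f ^ d)          ≤⟨ *-monoʳ-≤ f (+-monoˡ-≤ (c * f ^ d) (m^n>0 f d)) ⟩
    f * (f ^ d + c * f ^ d)      ≡⟨ rearrange f (f ^ d) c ⟩
    f ^ d * (f + c * f)          ≤⟨ *-monoʳ-≤ (f ^ d) (+-monoʳ-≤ f cf≤d) ⟩
    f ^ d * (f + d)              ≤⟨ bernoulli⁺ f d ⟩
    f * suc f ^ d                ∎)
    where
    open ≤-Reasoning
    rearrange : ∀ f a c → f * (a + c * a) ≡ a * (f + c * f)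
    rearrange = solve-∀

  -- `bernoulli⁻` with j/(1 + p) = 1/10.
  9*suc-^≤10*^ : ∀ p j .{{_ : NonZero j}} → suc p ≡ 10 * j → 9 * suc p ^ j ≤ 10 * p ^ j
  9*suc-^≤10*^ p j 1+p≡10j = *-cancelˡ-≤ j (+-cancelʳ-≤ (j * suc p ^ j) _ _ (begin
    j * (9 * suc p ^ j) + j * suc p ^ j   ≡⟨ collect j (suc p ^ j) ⟩
    suc p ^ j * (10 * j)                  ≡⟨ cong (suc p ^ j *_) (sym 1+p≡10j) ⟩
    suc p ^ j * suc p                     ≤⟨ bernoulli⁻ p j ⟩
    p ^ j * suc p + j * suc p ^ j         ≡⟨ cong (λ t → p ^ j * t + j * suc p ^ j) 1+p≡10j ⟩
    p ^ j * (10 * j) + j * suc p ^ j      ≡⟨ cong (_+ j * suc p ^ j) (rearrange (p ^ j) j) ⟩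
    j * (10 * p ^ j) + j * suc p ^ j      ∎))
    where
    open ≤-Reasoning
    collect : ∀ j a → j * (9 * a) + j * a ≡ a * (10 * j)
    collect = solve-∀
    rearrange : ∀ a j → a * (10 * j) ≡ j * (10 * a)
    rearrange = solve-∀

  square-* : ∀ k a → (k * a) * (k * a) ≡ (k * k) * (a * a)
  square-* = solve-∀

  square-^ : ∀ a n → a ^ n * a ^ n ≡ a ^ (2 * n)
  square-^ a n = trans (sym (^-distribˡ-+-* a n n)) (cong (λ t → a ^ (n + t)) (sym (+-identityʳ n)))

  -- With c = (1 + p)/p: k² ≤ c^(2Δ) ≤ c^(jd) ≤ (10/9)ᵈ. Thus (9/10)ᵈ pays for one label in each
  -- class.
  k*k*9^d≤10^d : ∀ p j k Δ d .{{_ : NonZero p}} .{{_ : NonZero j}} → suc p ≡ 10 * j → 2 * Δ ≤ j * d →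
                 k * p ^ Δ ≤ suc p ^ Δ → (k * k) * 9 ^ d ≤ 10 ^ d
  k*k*9^d≤10^d p j k Δ d 1+p≡10j 2Δ≤jd k≤ = *-cancelʳ-≤ _ _ (p ^ (j * d)) {{m^n≢0 p (j * d)}} (begin
    (k * k) * 9 ^ d * p ^ (j * d)             ≡⟨ rearrange (k * k) (9 ^ d) _ ⟩
    9 ^ d * ((k * k) * p ^ (j * d))           ≤⟨ *-monoʳ-≤ (9 ^ d) k²≤ ⟩
    9 ^ d * suc p ^ (j * d)                   ≡⟨ cong (9 ^ d *_) (sym (^-*-assoc (suc p) j d)) ⟩
    9 ^ d * (suc p ^ j) ^ d                   ≡⟨ sym (^-distribʳ-* 9 (suc p ^ j) d) ⟩
    (9 * suc p ^ j) ^ d                       ≤⟨ ^-monoˡ-≤ d (9*suc-^≤10*^ p j 1+p≡10j) ⟩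
    (10 * p ^ j) ^ d                          ≡⟨ ^-distribʳ-* 10 (p ^ j) d ⟩
    10 ^ d * (p ^ j) ^ d                      ≡⟨ cong (10 ^ d *_) (^-*-assoc p j d) ⟩
    10 ^ d * p ^ (j * d)                      ∎)
    where
    open ≤-Reasoning
    rearrange : ∀ a b c → a * b * c ≡ b * (a * c)
    rearrange = solve-∀
    -- The surplus in the exponent is absorbed by p^t ≤ (1 + p)^t.
    t = j * d ∸ 2 * Δ
    jd≡ : 2 * Δ + t ≡ j * d
    jd≡ = m+[n∸m]≡n 2Δ≤jd
    k²≤ : (k * k) * p ^ (j * d) ≤ suc p ^ (j * d)
    k²≤ = begin
      (k * k) * p ^ (j * d)                   ≡⟨ cong (λ z → (k * k) * p ^ z) (sym jd≡) ⟩
      (k * k) * p ^ (2 * Δ + t)               ≡⟨ cong ((k * k) *_) (^-distribˡ-+-* p (2 * Δ) t) ⟩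
      (k * k) * (p ^ (2 * Δ) * p ^ t)         ≡⟨ cong (λ z → (k * k) * (z * p ^ t)) (sym (square-^ p Δ)) ⟩
      (k * k) * (p ^ Δ * p ^ Δ * p ^ t)       ≡⟨ sym (*-assoc (k * k) _ _) ⟩
      (k * k) * (p ^ Δ * p ^ Δ) * p ^ t       ≡⟨ cong (_* p ^ t) (sym (square-* k (p ^ Δ))) ⟩
      k * p ^ Δ * (k * p ^ Δ) * p ^ t         ≤⟨ *-mono-≤ (*-mono-≤ k≤ k≤) (^-monoˡ-≤ t (n≤1+n p)) ⟩
      suc p ^ Δ * suc p ^ Δ * suc p ^ t       ≡⟨ cong (_* suc p ^ t) (square-^ (suc p) Δ) ⟩
      suc p ^ (2 * Δ) * suc p ^ t             ≡⟨ sym (^-distribˡ-+-* (suc p) (2 * Δ) t) ⟩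
      suc p ^ (2 * Δ + t)                     ≡⟨ cong (suc p ^_) jd≡ ⟩
      suc p ^ (j * d)                         ∎

  k*k≤n : ∀ p k n Δ .{{_ : NonZero p}} → k * p ^ Δ ≤ suc p ^ Δ → suc p ^ (2 * Δ) ≤ n * p ^ (2 * Δ) → k * k ≤ n
  k*k≤n p k n Δ k≤ n≥ = *-cancelʳ-≤ _ _ (p ^ (2 * Δ)) {{m^n≢0 p (2 * Δ)}} (begin
    k * k * p ^ (2 * Δ)           ≡⟨ cong (k * k *_) (sym (square-^ p Δ)) ⟩
    k * k * (p ^ Δ * p ^ Δ)       ≡⟨ sym (square-* k (p ^ Δ)) ⟩
    k * p ^ Δ * (k * p ^ Δ)       ≤⟨ *-mono-≤ k≤ k≤ ⟩
    suc p ^ Δ * suc p ^ Δ         ≡⟨ square-^ (suc p) Δ ⟩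
    suc p ^ (2 * Δ)               ≤⟨ n≥ ⟩
    n * p ^ (2 * Δ)               ∎)
    where open ≤-Reasoning

  -- The exceptional set adds one label to the k parts; k + 1 ≤ 2k unless k = 0, and that case is
  -- covered by `1 ≤ t`.
  suc-square≤ : ∀ k t → 1 ≤ t → k * k ≤ t → suc k * suc k ≤ 4 * t
  suc-square≤ zero    t 1≤t _    = ≤-trans 1≤t (m≤n*m t 4)
  suc-square≤ (suc k) t _   k²≤t = begin
    suc (suc k) * suc (suc k)              ≤⟨ m≤m+n _ (3 * (k * k) + 4 * k) ⟩
    suc (suc k) * suc (suc k) + (3 * (k * k) + 4 * k)  ≡⟨ expand k ⟩
    4 * (suc k * suc k)                    ≤⟨ *-monoʳ-≤ 4 k²≤t ⟩
    4 * t                                  ∎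
    where
    open ≤-Reasoning
    expand : ∀ k → suc (suc k) * suc (suc k) + (3 * (k * k) + 4 * k) ≡ 4 * (suc k * suc k)
    expand = solve-∀

  suc-square*≤ : ∀ k a b → a ≤ b → (k * k) * a ≤ b → (suc k * suc k) * a ≤ 4 * b
  suc-square*≤ zero    a b a≤b _     = ≤-trans (≤-reflexive (*-identityˡ a)) (≤-trans a≤b (m≤n*m b 4))
  suc-square*≤ (suc k) a b _   k²a≤b = begin
    suc (suc k) * suc (suc k) * a          ≤⟨ *-monoˡ-≤ a (suc-square≤ (suc k) (suc k * suc k) (s≤s z≤n) ≤-refl) ⟩
    4 * (suc k * suc k) * a                ≡⟨ *-assoc 4 (suc k * suc k) a ⟩
    4 * (suc k * suc k * a)                ≤⟨ *-monoʳ-≤ 4 k²a≤b ⟩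
    4 * b                                  ∎
    where open ≤-Reasoning

  -- 64 = 4 · 16: the 4ⁿ comes from passing from k to k + 1 labels, the 16ⁿ from the tables, whose
  -- (k + 1)² entries number at most 4n.
  block-count : ∀ n k d → 1 ≤ n → k * k ≤ n → (k * k) * 9 ^ d ≤ 10 ^ d →
                suc k ^ n * (suc k ^ n * (2 ^ suc k) ^ suc k) * 9 ^ (n * d) ≤ 64 ^ n * 10 ^ (n * d)
  block-count n k d 1≤n k²≤n k²9^d≤10^d = begin
    K ^ n * (K ^ n * (2 ^ K) ^ K) * 9 ^ (n * d)
      ≡⟨ cong₂ (λ s t → K ^ n * (K ^ n * s) * t) (^-*-assoc 2 K K) (trans (cong (9 ^_) (*-comm n d)) (sym (^-*-assoc 9 d n))) ⟩
    K ^ n * (K ^ n * 2 ^ (K * K)) * (9 ^ d) ^ n          ≡⟨ rearrange (K ^ n) _ _ ⟩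
    K ^ n * K ^ n * (9 ^ d) ^ n * 2 ^ (K * K)
      ≡⟨ cong (λ s → s * (9 ^ d) ^ n * 2 ^ (K * K)) (sym (^-distribʳ-* K K n)) ⟩
    (K * K) ^ n * (9 ^ d) ^ n * 2 ^ (K * K)
      ≡⟨ cong (_* 2 ^ (K * K)) (sym (^-distribʳ-* (K * K) (9 ^ d) n)) ⟩
    (K * K * 9 ^ d) ^ n * 2 ^ (K * K)
      ≤⟨ *-mono-≤ (^-monoˡ-≤ n K²9^d≤) (^-monoʳ-≤ 2 (suc-square≤ k n 1≤n k²≤n)) ⟩
    (4 * 10 ^ d) ^ n * 2 ^ (4 * n)
      ≡⟨ cong₂ _*_ (^-distribʳ-* 4 (10 ^ d) n) (sym (^-*-assoc 2 4 n)) ⟩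
    4 ^ n * (10 ^ d) ^ n * 16 ^ n                        ≡⟨ rearrange′ (4 ^ n) ((10 ^ d) ^ n) (16 ^ n) ⟩
    4 ^ n * 16 ^ n * (10 ^ d) ^ n
      ≡⟨ cong₂ _*_ (sym (^-distribʳ-* 4 16 n)) (trans (^-*-assoc 10 d n) (cong (10 ^_) (*-comm d n))) ⟩
    64 ^ n * 10 ^ (n * d)                                ∎
    where
    open ≤-Reasoning
    K = suc k
    K²9^d≤ : K * K * 9 ^ d ≤ 4 * 10 ^ d
    K²9^d≤ = suc-square*≤ k (9 ^ d) (10 ^ d) (^-monoˡ-≤ d (n≤1+n 9)) k²9^d≤10^d
    rearrange : ∀ a b c → a * (a * b) * c ≡ a * a * c * b
    rearrange = solve-∀
    rearrange′ : ∀ a b c → a * b * c ≡ a * c * b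
    rearrange′ = solve-∀

  ∑-^-≤ : (L : List A) (h : A → ℕ) (c D M : ℕ) → All (λ x → c * h x ≤ D) L →
          c ^ M * ∑ L (λ x → h x ^ M) ≤ length L * D ^ M
  ∑-^-≤ []      h c D M []       = ≤-reflexive (*-zeroʳ (c ^ M))
  ∑-^-≤ (x ∷ L) h c D M (p ∷ ps) = begin
    c ^ M * (h x ^ M + ∑ L (λ x → h x ^ M))           ≡⟨ *-distribˡ-+ (c ^ M) _ _ ⟩
    c ^ M * h x ^ M + c ^ M * ∑ L (λ x → h x ^ M)     ≡⟨ cong (_+ _) (sym (^-distribʳ-* c (h x) M)) ⟩
    (c * h x) ^ M + c ^ M * ∑ L (λ x → h x ^ M)       ≤⟨ +-mono-≤ (^-monoˡ-≤ M p) (∑-^-≤ L h c D M ps) ⟩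
    D ^ M + length L * D ^ M                          ∎
    where open ≤-Reasoning

  -- Relative to `U ^ (n * d)`, each list contributes at most 64ⁿ(f/g)ⁿᵈ; for `L₁` the factor
  -- (9/10)ⁿᵈ has been spent on its length. Since 2 ≤ 2ⁿ, the total is at most (128(f/g)ᵈ)ⁿ < 1.
  potential-bound : (L₁ L₂ : List A) (h : A → ℕ) (n d f g U : ℕ) .{{_ : NonZero n}} .{{_ : NonZero U}} →
    All (λ x → 10 * g * h x ≤ 9 * f * U) L₁ → All (λ x → g * h x ≤ f * U) L₂ →
    length L₁ * 9 ^ (n * d) ≤ 64 ^ n * 10 ^ (n * d) → length L₂ ≤ 64 ^ n →
    128 * f ^ d < g ^ d →
    ∑ (L₁ ++ L₂) (λ x → h x ^ (n * d)) < U ^ (n * d)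
  potential-bound L₁ L₂ h n d f g U small₁ small₂ count₁ count₂ 128f^d<g^d =
    *-cancelˡ-< (g ^ M) _ _ (begin-strict
      g ^ M * ∑ (L₁ ++ L₂) w              ≡⟨ cong (g ^ M *_) (∑-++ L₁ L₂ w) ⟩
      g ^ M * (∑ L₁ w + ∑ L₂ w)           ≡⟨ *-distribˡ-+ (g ^ M) _ _ ⟩
      g ^ M * ∑ L₁ w + g ^ M * ∑ L₂ w     ≤⟨ +-mono-≤ bound₁ bound₂ ⟩
      64 ^ n * (f * U) ^ M + 64 ^ n * (f * U) ^ M  ≡⟨ sym (*-distribʳ-+ ((f * U) ^ M) (64 ^ n) (64 ^ n)) ⟩
      (64 ^ n + 64 ^ n) * (f * U) ^ M     ≤⟨ *-monoˡ-≤ _ (64^n+64^n≤128^n n) ⟩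
      128 ^ n * (f * U) ^ M               ≡⟨ cong (128 ^ n *_) (^-distribʳ-* f U M) ⟩
      128 ^ n * (f ^ M * U ^ M)           ≡⟨ sym (*-assoc (128 ^ n) _ _) ⟩
      128 ^ n * f ^ M * U ^ M             ≡⟨ cong (λ s → 128 ^ n * s * U ^ M) (^-M f) ⟩
      128 ^ n * (f ^ d) ^ n * U ^ M       ≡⟨ cong (_* U ^ M) (sym (^-distribʳ-* 128 (f ^ d) n)) ⟩
      (128 * f ^ d) ^ n * U ^ M           <⟨ *-monoˡ-< (U ^ M) {{m^n≢0 U M}} (^-monoˡ-< n 128f^d<g^d) ⟩
      (g ^ d) ^ n * U ^ M                 ≡⟨ cong (_* U ^ M) (sym (^-M g)) ⟩
      g ^ M * U ^ M                       ∎)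
    where
    open ≤-Reasoning
    M = n * d
    w = λ x → h x ^ M
    ^-M : ∀ a → a ^ M ≡ (a ^ d) ^ n
    ^-M a = trans (cong (a ^_) (*-comm n d)) (sym (^-*-assoc a d n))
    64^n+64^n≤128^n : ∀ n .{{_ : NonZero n}} → 64 ^ n + 64 ^ n ≤ 128 ^ n
    64^n+64^n≤128^n n = begin
      64 ^ n + 64 ^ n    ≡⟨ double (64 ^ n) ⟩
      2 ^ 1 * 64 ^ n     ≤⟨ *-monoˡ-≤ (64 ^ n) (^-monoʳ-≤ 2 (>-nonZero⁻¹ n)) ⟩
      2 ^ n * 64 ^ n     ≡⟨ sym (^-distribʳ-* 2 64 n) ⟩
      128 ^ n            ∎
      where
      double : ∀ a → a + a ≡ 2 * a
      double = solve-∀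
    bound₁ : g ^ M * ∑ L₁ w ≤ 64 ^ n * (f * U) ^ M
    bound₁ = *-cancelˡ-≤ (10 ^ M) {{m^n≢0 10 M}} (begin
      10 ^ M * (g ^ M * ∑ L₁ w)           ≡⟨ sym (*-assoc (10 ^ M) _ _) ⟩
      10 ^ M * g ^ M * ∑ L₁ w             ≡⟨ cong (_* ∑ L₁ w) (sym (^-distribʳ-* 10 g M)) ⟩
      (10 * g) ^ M * ∑ L₁ w               ≤⟨ ∑-^-≤ L₁ h (10 * g) (9 * f * U) M small₁ ⟩
      length L₁ * (9 * f * U) ^ M         ≡⟨ cong (λ t → length L₁ * t ^ M) (*-assoc 9 f U) ⟩
      length L₁ * (9 * (f * U)) ^ M       ≡⟨ cong (length L₁ *_) (^-distribʳ-* 9 (f * U) M) ⟩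
      length L₁ * (9 ^ M * (f * U) ^ M)   ≡⟨ sym (*-assoc (length L₁) _ _) ⟩
      length L₁ * 9 ^ M * (f * U) ^ M     ≤⟨ *-monoˡ-≤ _ count₁ ⟩
      64 ^ n * 10 ^ M * (f * U) ^ M       ≡⟨ rearrange (64 ^ n) (10 ^ M) _ ⟩
      10 ^ M * (64 ^ n * (f * U) ^ M)     ∎)
      where
      rearrange : ∀ a b c → a * b * c ≡ b * (a * c)
      rearrange = solve-∀
    bound₂ : g ^ M * ∑ L₂ w ≤ 64 ^ n * (f * U) ^ M
    bound₂ = ≤-trans (∑-^-≤ L₂ h g (f * U) M small₂) (*-monoˡ-≤ _ count₂)

  -- Unsaturated vertices and available pairs

  -- The saturated vertices satisfy (n - w)Δ ≤ nd ≤ nΔ/b, hence number at most n/b.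
  n∸n/b≤w : ∀ n Δ b d w .{{_ : NonZero b}} .{{_ : NonZero Δ}} → b * d ≤ Δ → n * Δ ≤ n * d + w * Δ → n ∸ n / b ≤ w
  n∸n/b≤w n Δ b d w bd≤Δ nΔ≤ = m≤n+o⇒m∸n≤o n (n / b) (begin
    n                ≤⟨ m≤n+m∸n n w ⟩
    w + (n ∸ w)      ≡⟨ +-comm w (n ∸ w) ⟩
    (n ∸ w) + w      ≤⟨ +-monoˡ-≤ w n∸w≤n/b ⟩
    n / b + w        ∎)
    where
    open ≤-Reasoning
    [n∸w]b≤n : (n ∸ w) * b ≤ n
    [n∸w]b≤n = *-cancelʳ-≤ _ _ Δ (begin
      (n ∸ w) * b * Δ           ≡⟨ rearrange (n ∸ w) b Δ ⟩
      b * ((n ∸ w) * Δ)         ≡⟨ cong (b *_) (*-distribʳ-∸ Δ n w) ⟩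
      b * (n * Δ ∸ w * Δ)
        ≤⟨ *-monoʳ-≤ b (m≤n+o⇒m∸n≤o (n * Δ) (w * Δ) (≤-trans nΔ≤ (≤-reflexive (+-comm (n * d) _)))) ⟩
      b * (n * d)               ≡⟨ rearrange′ b n d ⟩
      n * (b * d)               ≤⟨ *-monoʳ-≤ n bd≤Δ ⟩
      n * Δ                     ∎)
      where
      rearrange : ∀ a b c → a * b * c ≡ b * (a * c)
      rearrange = solve-∀
      rearrange′ : ∀ a b c → a * (b * c) ≡ b * (a * c)
      rearrange′ = solve-∀
    n∸w≤n/b : n ∸ w ≤ n / b
    n∸w≤n/b = ≤-trans (≤-reflexive (sym (m*n/n≡m (n ∸ w) b))) (/-monoˡ-≤ b [n∸w]b≤n)

  [b∸1]*n≤b*[n∸n/b] : ∀ n b .{{_ : NonZero b}} → (b ∸ 1) * n ≤ b * (n ∸ n / b)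
  [b∸1]*n≤b*[n∸n/b] n b = begin
    (b ∸ 1) * n                ≡⟨ *-distribʳ-∸ n b 1 ⟩
    b * n ∸ 1 * n              ≡⟨ cong (b * n ∸_) (*-identityˡ n) ⟩
    b * n ∸ n                  ≤⟨ ∸-monoʳ-≤ (b * n) (m/n*n≤m n b) ⟩
    b * n ∸ n / b * b          ≡⟨ cong (b * n ∸_) (*-comm (n / b) b) ⟩
    b * n ∸ b * (n / b)        ≡⟨ sym (*-distribˡ-∸ b n (n / b)) ⟩
    b * (n ∸ n / b)            ∎
    where open ≤-Reasoning

  -- The ratio a/b is squared and then reduced by the common factor `z`, with rounding allowed in
  -- the numerator only.
  square-ratio : ∀ {a b n u} z p q .{{_ : NonZero z}} → a * n ≤ b * u → z * p ≤ a * a → b * b ≡ z * q →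
                 p * (n * n) ≤ q * (u * u)
  square-ratio {a} {b} {n} {u} z p q an≤bu zp≤a² b²≡zq = *-cancelˡ-≤ z (begin
    z * (p * (n * n))      ≡⟨ sym (*-assoc z p _) ⟩
    z * p * (n * n)        ≤⟨ *-monoˡ-≤ (n * n) zp≤a² ⟩
    a * a * (n * n)        ≡⟨ sym (square-* a n) ⟩
    a * n * (a * n)        ≤⟨ *-mono-≤ an≤bu an≤bu ⟩
    b * u * (b * u)        ≡⟨ square-* b u ⟩
    b * b * (u * u)        ≡⟨ cong (_* (u * u)) b²≡zq ⟩
    z * q * (u * u)        ≡⟨ *-assoc z q _ ⟩
    z * (q * (u * u))      ∎)
    where open ≤-Reasoning

  -- Bad sets and their densities

  -- Labellings and table are vectors so that the whole family can be enumerated. The table is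
  -- arbitrary, which makes the family independent of any graph.
  blockSet : Vec (Fin k) n × Vec (Fin k) n × Vec (Vec Bool k) k → Edge n → Bool
  blockSet (p , q , R) (x , y) = lookup (lookup R (lookup p x)) (lookup q y)

  rectangleComplement : Subset n × Subset n → Edge n → Bool
  rectangleComplement (X , Y) (x , y) = not (lookup X x ∧ lookup Y y)

  ∣∣ₑ≡∑∑ : (S : Edge n → Bool) → ∣ S ∣ₑ ≡ ∑ (allFin n) (λ x → ∑ (allFin n) (λ y → 𝟙 (S (x , y))))
  ∣∣ₑ≡∑∑ {n} S = ∑-cartesianProduct (allFin n) (allFin n) (𝟙 ∘ S)

  ∑∑-const : ∀ n → ∑ (allFin n) (λ _ → ∑ (allFin n) (λ _ → 1)) ≡ n * n
  ∑∑-const n = trans (∑-cong (allFin n) (λ _ → trans (∑-allFin-const n 1) (*-identityʳ n))) (∑-allFin-const n n)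

  ∣rectangleComplement∣ : (X Y : Subset n) → ∣ rectangleComplement (X , Y) ∣ₑ + ∣ X ∣ * ∣ Y ∣ ≡ n * n
  ∣rectangleComplement∣ {n} X Y = begin
    ∣ S ∣ₑ + ∣ X ∣ * ∣ Y ∣
      ≡⟨ cong₂ _+_ (∣∣ₑ≡∑∑ S) (cong₂ _*_ (∣∣≡∑ X) (∣∣≡∑ Y)) ⟩
    ∑ V (λ x → ∑ V (λ y → 𝟙 (S (x , y)))) + ∑ V (𝟙 ∘ lookup X) * ∑ V (𝟙 ∘ lookup Y)
      ≡⟨ cong (∑ V (λ x → ∑ V (λ y → 𝟙 (S (x , y)))) +_) (sym (∑-product V V (𝟙 ∘ lookup X) (𝟙 ∘ lookup Y))) ⟩
    ∑ V (λ x → ∑ V (λ y → 𝟙 (S (x , y)))) + ∑ V (λ x → ∑ V (λ y → r x y))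
      ≡⟨ sym (∑-+ V (λ x → ∑ V (λ y → 𝟙 (S (x , y)))) (λ x → ∑ V (r x))) ⟩
    ∑ V (λ x → ∑ V (λ y → 𝟙 (S (x , y))) + ∑ V (r x))
      ≡⟨ ∑-cong V (λ x → sym (∑-+ V (λ y → 𝟙 (S (x , y))) (r x))) ⟩
    ∑ V (λ x → ∑ V (λ y → 𝟙 (S (x , y)) + r x y))
      ≡⟨ ∑-cong V (λ x → ∑-cong V (λ y → complementary (lookup X x) (lookup Y y))) ⟩
    ∑ V (λ x → ∑ V (λ y → 1))
      ≡⟨ ∑∑-const n ⟩
    n * n ∎
    where
    open ≡-Reasoning
    V = allFin n
    S = rectangleComplement (X , Y)
    r : Fin n → Fin n → ℕ
    r x y = 𝟙 (lookup X x) * 𝟙 (lookup Y y)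
    complementary : ∀ a b → 𝟙 (not (a ∧ b)) + 𝟙 a * 𝟙 b ≡ 1
    complementary false b     = refl
    complementary true  false = refl
    complementary true  true  = refl

  ∣rectangleComplement∣≤ : ∀ c m (X Y : Subset n) → c * c ≡ suc m → n ≤ c * ∣ X ∣ → n ≤ c * ∣ Y ∣ →
                           c * c * ∣ rectangleComplement (X , Y) ∣ₑ ≤ m * (n * n)
  ∣rectangleComplement∣≤ {n} c m X Y c²≡1+m n≤cX n≤cY = +-cancelʳ-≤ (n * n) _ _ (begin
    c * c * s + n * n                           ≤⟨ +-monoʳ-≤ (c * c * s) (*-mono-≤ n≤cX n≤cY) ⟩
    c * c * s + c * ∣ X ∣ * (c * ∣ Y ∣)         ≡⟨ collect c s ∣ X ∣ ∣ Y ∣ ⟩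
    c * c * (s + ∣ X ∣ * ∣ Y ∣)                 ≡⟨ cong₂ _*_ c²≡1+m (∣rectangleComplement∣ X Y) ⟩
    suc m * (n * n)                             ≡⟨ +-comm (n * n) (m * (n * n)) ⟩
    m * (n * n) + n * n                         ∎)
    where
    open ≤-Reasoning
    s = ∣ rectangleComplement (X , Y) ∣ₑ
    collect : ∀ c s a b → c * c * s + c * a * (c * b) ≡ c * c * (s + a * b)
    collect = solve-∀

  𝟙-does≤ : ∀ {C : Set} (c? : Dec C) {m} → (C → 1 ≤ m) → 𝟙 (does c?) ≤ m
  𝟙-does≤ (yes c) 1≤m = 1≤m c
  𝟙-does≤ (no _)  _   = z≤n

  module _ (H : BipartiteGraph n) (P Q : Partition n k) where
    open BipartiteGraph H
    open Partition P using () renaming (part to X; rest to Dx; cover to coverX)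
    open Partition Q using () renaming (part to Y; rest to Dy; cover to coverY)

    label : {Z : Fin k → Set} {D : Set} → (∃[ i ] Z i) ⊎ D → Fin (suc k)
    label (inj₁ (i , _)) = suc i
    label (inj₂ _)       = zero

    touching : Fin (suc k) → Fin (suc k) → Bool
    touching zero    _       = true
    touching (suc _) zero    = true
    touching (suc i) (suc j) = does (i ≟ j) ∨ does (e (X i) (Y j) >? 0)

    -- Label zero stands for the exceptional set; the table relates all labels that an edge of H may join.
    blocks : Vec (Fin (suc k)) n × Vec (Fin (suc k)) n × Vec (Vec Bool (suc k)) (suc k)
    blocks = tabulate (label ∘ coverX) , tabulate (label ∘ coverY) , tabulate (λ a → tabulate (touching a))

    blockSet-blocks : ∀ x y → blockSet blocks (x , y) ≡ touching (label (coverX x)) (label (coverY y))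
    blockSet-blocks x y
      rewrite lookup∘tabulate (label ∘ coverX) x | lookup∘tabulate (label ∘ coverY) y
            | lookup∘tabulate (λ a → tabulate (touching a)) (label (coverX x))
            = lookup∘tabulate (touching (label (coverX x))) (label (coverY y))

    -- An edge between two ordinary parts is itself the witness that its block is non-empty.
    edges⊆blockSet : ∀ x y → T (adj x y) → blockSet blocks (x , y) ≡ true
    edges⊆blockSet x y xy = trans (blockSet-blocks x y) (joined (coverX x) (coverY y))
      where
      joined : (cx : (∃[ i ] x ∈ₛ X i) ⊎ x ∈ₛ Dx) (cy : (∃[ j ] y ∈ₛ Y j) ⊎ y ∈ₛ Dy) →
               touching (label cx) (label cy) ≡ true
      joined (inj₂ _)         _                = refl
      joined (inj₁ _)         (inj₂ _)         = refl
      joined (inj₁ (i , x∈X)) (inj₁ (j , y∈Y)) with does (i ≟ j)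
      ... | true  = refl
      ... | false = dec-true (e (X i) (Y j) >? 0) (e>0 H (X i) (Y j) x∈X y∈Y xy)

    private
      V = allFin n

      offDiagonal? : (ij : Fin k × Fin k) → Dec (¬ proj₁ ij ≡ proj₂ ij × e (X (proj₁ ij)) (Y (proj₂ ij)) > 0)
      offDiagonal? (i , j) = ¬? (i ≟ j) ×-dec (e (X i) (Y j) >? 0)

      F : List (Fin k × Fin k)
      F = filter offDiagonal? (cartesianProduct (allFin k) (allFin k))

      product : Fin n → Fin n → Fin k × Fin k → ℕ
      product x y (i , j) = 𝟙 (lookup (X i) x) * 𝟙 (lookup (Y j) y)

      -- Indexed by the label of `x` instead of summed over all i: each `x` then costs at most one
      -- part of Y, which yields `n * β` in total.
      diagonal : Fin (suc k) → Fin n → ℕ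
      diagonal zero    y = 0
      diagonal (suc i) y = 𝟙 (lookup (Y i) y)

    -- Every pair of the block set is charged to one of four causes: `x` exceptional, `y`
    -- exceptional, equal indices, or an off-diagonal block counted in item 1.
    𝟙-blockSet≤ : ∀ x y → 𝟙 (blockSet blocks (x , y)) ≤
      𝟙 (lookup Dx x) + (𝟙 (lookup Dy y) + (diagonal (label (coverX x)) y + ∑ F (product x y)))
    𝟙-blockSet≤ x y rewrite blockSet-blocks x y = charge (coverX x) (coverY y)
      where
      dx = 𝟙 (lookup Dx x)
      dy = 𝟙 (lookup Dy y)
      charge : (cx : (∃[ i ] x ∈ₛ X i) ⊎ x ∈ₛ Dx) (cy : (∃[ j ] y ∈ₛ Y j) ⊎ y ∈ₛ Dy) →
               𝟙 (touching (label cx) (label cy)) ≤ dx + (dy + (diagonal (label cx) y + ∑ F (product x y)))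
      charge (inj₂ x∈D)       _                rewrite []=⇒lookup x∈D = s≤s z≤n
      charge (inj₁ _)         (inj₂ y∈D)       rewrite []=⇒lookup y∈D = m≤n⇒m≤o+n dx (s≤s z≤n)
      charge (inj₁ (i , x∈X)) (inj₁ (j , y∈Y)) with i ≟ j
      ... | yes refl rewrite []=⇒lookup y∈Y = m≤n⇒m≤o+n dx (m≤n⇒m≤o+n dy (s≤s z≤n))
      ... | no  i≢j = 𝟙-does≤ (e (X i) (Y j) >? 0) (λ e>0 →
        m≤n⇒m≤o+n dx (m≤n⇒m≤o+n dy (m≤n⇒m≤o+n (diagonal (suc i) y) (begin
        1                    ≡⟨ sym (cong₂ (λ a b → 𝟙 a * 𝟙 b) ([]=⇒lookup x∈X) ([]=⇒lookup y∈Y)) ⟩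
        product x y (i , j)  ≤⟨ ∑-∈ (product x y) (∈-filter⁺ offDiagonal?
                                  (∈-cartesianProduct⁺ (∈-allFin i) (∈-allFin j)) (i≢j , e>0)) ⟩
        ∑ F (product x y)    ∎))))
        where open ≤-Reasoning

    ∑∑-product : ∑ V (λ x → ∑ V (λ y → ∑ F (product x y))) ≡ offDiagonalWeight H P Q
    ∑∑-product = begin
      ∑ V (λ x → ∑ V (λ y → ∑ F (product x y)))                ≡⟨ ∑-cong V (λ x → ∑-swap V F (product x)) ⟩
      ∑ V (λ x → ∑ F (λ ij → ∑ V (λ y → product x y ij)))
        ≡⟨ ∑-swap V F (λ x ij → ∑ V (λ y → product x y ij)) ⟩
      ∑ F (λ ij → ∑ V (λ x → ∑ V (λ y → product x y ij)))
        ≡⟨ ∑-cong F (λ (i , j) → ∑-product V V (𝟙 ∘ lookup (X i)) (𝟙 ∘ lookup (Y j))) ⟩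
      ∑ F (λ (i , j) → ∑ V (𝟙 ∘ lookup (X i)) * ∑ V (𝟙 ∘ lookup (Y j)))
        ≡⟨ ∑-cong F (λ (i , j) → sym (cong₂ _*_ (∣∣≡∑ (X i)) (∣∣≡∑ (Y j)))) ⟩
      offDiagonalWeight H P Q                                  ∎
      where open ≡-Reasoning

    ∣blockSet∣≤ : ∀ β → (∀ j → ∣ Y j ∣ ≤ β) →
      ∣ blockSet blocks ∣ₑ ≤ ∣ Dx ∣ * n + (n * ∣ Dy ∣ + (n * β + offDiagonalWeight H P Q))
    ∣blockSet∣≤ β Y≤β = begin
      ∣ blockSet blocks ∣ₑ                                     ≡⟨ ∣∣ₑ≡∑∑ (blockSet blocks) ⟩
      ∑ V (λ x → ∑ V (λ y → 𝟙 (blockSet blocks (x , y))))      ≤⟨ ∑-mono V (λ x → ∑-mono V (𝟙-blockSet≤ x)) ⟩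
      ∑∑ (λ x y → t₁ x y + (t₂ x y + (t₃ x y + t₄ x y)))       ≡⟨ ∑∑-+ t₁ (λ x y → t₂ x y + (t₃ x y + t₄ x y)) ⟩
      ∑∑ t₁ + ∑∑ (λ x y → t₂ x y + (t₃ x y + t₄ x y))
        ≡⟨ cong (∑∑ t₁ +_) (∑∑-+ t₂ (λ x y → t₃ x y + t₄ x y)) ⟩
      ∑∑ t₁ + (∑∑ t₂ + ∑∑ (λ x y → t₃ x y + t₄ x y))           ≡⟨ cong (λ s → ∑∑ t₁ + (∑∑ t₂ + s)) (∑∑-+ t₃ t₄) ⟩
      ∑∑ t₁ + (∑∑ t₂ + (∑∑ t₃ + ∑∑ t₄))
        ≤⟨ +-mono-≤ (≤-reflexive ∑∑t₁) (+-mono-≤ (≤-reflexive ∑∑t₂) (+-mono-≤ ∑∑t₃ (≤-reflexive ∑∑-product))) ⟩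
      ∣ Dx ∣ * n + (n * ∣ Dy ∣ + (n * β + offDiagonalWeight H P Q)) ∎
      where
      open ≤-Reasoning
      ∑∑ : (Fin n → Fin n → ℕ) → ℕ
      ∑∑ t = ∑ V (λ x → ∑ V (t x))
      ∑∑-+ : ∀ s t → ∑∑ (λ x y → s x y + t x y) ≡ ∑∑ s + ∑∑ t
      ∑∑-+ s t = trans (∑-cong V (λ x → ∑-+ V (s x) (t x))) (∑-+ V (λ x → ∑ V (s x)) (λ x → ∑ V (t x)))
      t₁ t₂ t₃ t₄ : Fin n → Fin n → ℕ
      t₁ x y = 𝟙 (lookup Dx x)
      t₂ x y = 𝟙 (lookup Dy y)
      t₃ x y = diagonal (label (coverX x)) y
      t₄ x y = ∑ F (product x y)
      ∑∑t₁ : ∑∑ t₁ ≡ ∣ Dx ∣ * n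
      ∑∑t₁ = trans (∑-cong V (λ x → trans (∑-allFin-const n (𝟙 (lookup Dx x))) (*-comm n _)))
                   (trans (∑-*ʳ V (𝟙 ∘ lookup Dx) n) (cong (_* n) (sym (∣∣≡∑ Dx))))
      ∑∑t₂ : ∑∑ t₂ ≡ n * ∣ Dy ∣
      ∑∑t₂ = trans (∑-cong V (λ _ → sym (∣∣≡∑ Dy))) (∑-allFin-const n ∣ Dy ∣)
      ∑-diagonal≤ : ∀ a → ∑ V (diagonal a) ≤ β
      ∑-diagonal≤ zero    = ≤-trans (≤-reflexive (trans (∑-allFin-const n 0) (*-zeroʳ n))) z≤n
      ∑-diagonal≤ (suc i) = ≤-trans (≤-reflexive (sym (∣∣≡∑ (Y i)))) (Y≤β i)
      ∑∑t₃ : ∑∑ t₃ ≤ n * β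
      ∑∑t₃ = ≤-trans (∑-mono V (λ x → ∑-diagonal≤ (label (coverX x)))) (≤-reflexive (∑-allFin-const n β))

  -- A graph that escapes every bad set

  module _ (n k Δ d u f g : ℕ) .{{_ : NonZero n}} .{{_ : NonZero (u * u)}}
    (many-unsaturated : ∀ w → n * Δ ≤ n * d + w * Δ → u ≤ w)
    (k²≤n : k * k ≤ n) (k²9^d≤10^d : (k * k) * 9 ^ d ≤ 10 ^ d) (128f^d<g^d : 128 * f ^ d < g ^ d)
    where

    private
      blockIndices : List (Vec (Fin (suc k)) n × Vec (Fin (suc k)) n × Vec (Vec Bool (suc k)) (suc k))
      blockIndices = cartesianProduct (allVecs (allFin (suc k)) n) (cartesianProduct (allVecs (allFin (suc k)) n)
        (allVecs (allVecs (true ∷ false ∷ []) (suc k)) (suc k)))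

      rectangleIndices : List (Subset n × Subset n)
      rectangleIndices = cartesianProduct (allVecs (true ∷ false ∷ []) n) (allVecs (true ∷ false ∷ []) n)

      ∈-bools : ∀ b → b ∈ true ∷ false ∷ []
      ∈-bools true  = here refl
      ∈-bools false = there (here refl)

      small₁? : (S : Edge n → Bool) → Dec (10 * g * ∣ S ∣ₑ ≤ 9 * f * (u * u))
      small₁? S = 10 * g * ∣ S ∣ₑ ≤? 9 * f * (u * u)

      small₂? : (S : Edge n → Bool) → Dec (g * ∣ S ∣ₑ ≤ f * (u * u))
      small₂? S = g * ∣ S ∣ₑ ≤? f * (u * u)

      -- An arbitrary table or rectangle may give too dense a set; filtering makes the density bound
      -- hold for every listed set.
      L₁ L₂ : List (Edge n → Bool)
      L₁ = filter small₁? (map blockSet blockIndices)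
      L₂ = filter small₂? (map rectangleComplement rectangleIndices)

      length-L₁ : length L₁ ≤ suc k ^ n * (suc k ^ n * (2 ^ suc k) ^ suc k)
      length-L₁ = begin
        length L₁                             ≤⟨ length-filter small₁? (map blockSet blockIndices) ⟩
        length (map blockSet blockIndices)    ≡⟨ length-map blockSet blockIndices ⟩
        length blockIndices                   ≡⟨ length-cartesianProductWith _,_ labels _ ⟩
        length labels * length (cartesianProduct labels tables)
          ≡⟨ cong (length labels *_) (length-cartesianProductWith _,_ labels tables) ⟩
        length labels * (length labels * length tables)
          ≡⟨ cong₂ (λ s t → s * (s * t)) length-labels length-tables ⟩
        suc k ^ n * (suc k ^ n * (2 ^ suc k) ^ suc k) ∎
        where
        open ≤-Reasoning
        labels = allVecs (allFin (suc k)) n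
        tables = allVecs (allVecs (true ∷ false ∷ []) (suc k)) (suc k)
        length-labels : length labels ≡ suc k ^ n
        length-labels = trans (length-allVecs (allFin (suc k)) n) (cong (_^ n) {length (allFin (suc k))} {suc k} (length-tabulate id))
        length-tables : length tables ≡ (2 ^ suc k) ^ suc k
        length-tables = trans (length-allVecs (allVecs (true ∷ false ∷ []) (suc k)) (suc k)) (cong (_^ suc k) (length-allVecs (true ∷ false ∷ []) (suc k)))

      length-L₂ : length L₂ ≤ 64 ^ n
      length-L₂ = begin
        length L₂
          ≤⟨ length-filter small₂? (map rectangleComplement rectangleIndices) ⟩
        length (map rectangleComplement rectangleIndices) ≡⟨ length-map rectangleComplement rectangleIndices ⟩
        length rectangleIndices                          ≡⟨ length-cartesianProductWith _,_ subsets subsets ⟩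
        length subsets * length subsets                  ≡⟨ cong₂ _*_ (length-allVecs _ n) (length-allVecs _ n) ⟩
        2 ^ n * 2 ^ n                                    ≡⟨ sym (^-distribʳ-* 2 2 n) ⟩
        4 ^ n                                            ≤⟨ ^-monoˡ-≤ n (m≤m+n 4 60) ⟩
        64 ^ n                                           ∎
        where
        open ≤-Reasoning
        subsets = allVecs (true ∷ false ∷ []) n

    -- A pair escaping the complement of a rectangle is an edge inside the rectangle, so item 2 is
    -- immediate. Item 1 stays in the form of an escape, to be contradicted later by the block set
    -- built from `H` itself.
    robust-graph :
      Σ[ H ∈ BipartiteGraph n ] (BipartiteGraph.MaxDegree≤ H Δ
        × (∀ B → 10 * g * ∣ blockSet {suc k} B ∣ₑ ≤ 9 * f * (u * u) →
             Σ[ x ∈ Fin n ] Σ[ y ∈ Fin n ] (T (BipartiteGraph.adj H x y) × blockSet B (x , y) ≡ false))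
        × (∀ X Y → g * ∣ rectangleComplement (X , Y) ∣ₑ ≤ f * (u * u) → BipartiteGraph.e H X Y > 0))
    robust-graph =
      let H , degree , escapes = escaping-graph n Δ (n * d) u many-unsaturated (L₁ ++ L₂)
            (potential-bound L₁ L₂ ∣_∣ₑ n d f g (u * u)
              (all-filter small₁? (map blockSet blockIndices)) (all-filter small₂? (map rectangleComplement rectangleIndices))
              (≤-trans (*-monoˡ-≤ _ length-L₁) (block-count n k d (ℕ.>-nonZero⁻¹ n) k²≤n k²9^d≤10^d))
              length-L₂ 128f^d<g^d)
      in H , degree
       , (λ B small → escapes (∈-++⁺ˡ (∈-filter⁺ small₁? (∈-map⁺ blockSet (∈-blockIndices B)) small)))
       , (λ X Y small →
           let x , y , xy , S≡false = escapes (∈-++⁺ʳ L₁ (∈-filter⁺ small₂? (∈-map⁺ rectangleComplement (∈-rectangleIndices X Y)) small))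
               x∈X , y∈Y = both (lookup X x) (lookup Y y) S≡false
           in e>0 H X Y (lookup⇒[]= x X x∈X) (lookup⇒[]= y Y y∈Y) xy)
      where
      ∈-blockIndices : ∀ B → B ∈ blockIndices
      ∈-blockIndices (p , q , R) = ∈-cartesianProduct⁺ (∈-allVecs ∈-allFin p)
        (∈-cartesianProduct⁺ (∈-allVecs ∈-allFin q) (∈-allVecs (∈-allVecs ∈-bools) R))
      ∈-rectangleIndices : ∀ X Y → (X , Y) ∈ rectangleIndices
      ∈-rectangleIndices X Y = ∈-cartesianProduct⁺ (∈-allVecs ∈-bools X) (∈-allVecs ∈-bools Y)
      both : ∀ a b → not (a ∧ b) ≡ false → a ≡ true × b ≡ true
      both true true _ = refl , refl

  -- Comparing densities

  -- For `b ≤ m` the remainder is at most b⌊m/b⌋, so rounding down loses at most a factor 2.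
  2*m≤4*b*[m/b] : ∀ m b .{{_ : NonZero b}} → b ≤ m → 2 * m ≤ 4 * b * (m / b)
  2*m≤4*b*[m/b] m b b≤m = begin
    2 * m                                  ≡⟨ cong (2 *_) (m≡m%n+[m/n]*n m b) ⟩
    2 * (m % b + m / b * b)                ≤⟨ *-monoʳ-≤ 2 (+-monoˡ-≤ (m / b * b) m%b≤) ⟩
    2 * (m / b * b + m / b * b)            ≡⟨ collect (m / b) b ⟩
    4 * b * (m / b)                        ∎
    where
    open ≤-Reasoning
    m%b≤ : m % b ≤ m / b * b
    m%b≤ = ≤-trans (m%n≤n m b) (≤-trans (≤-reflexive (sym (*-identityˡ b))) (*-monoˡ-≤ b (m≥n⇒m/n>0 b≤m)))
    collect : ∀ q b → 2 * (q * b + q * b) ≡ 4 * b * q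
    collect = solve-∀

  -- s/U = (s/N)(N/U) ≤ (e/c)(q/p) ≤ b/a. It turns a density among all pairs into one among the
  -- available pairs.
  scale : ∀ {s N U} a b c e p q .{{_ : NonZero (c * p)}} → a * e * q ≤ b * c * p →
          p * N ≤ q * U → c * s ≤ e * N → a * s ≤ b * U
  scale {s} {N} {U} a b c e p q aeq≤bcp pN≤qU cs≤eN = *-cancelˡ-≤ (c * p) (begin
    c * p * (a * s)        ≡⟨ r₁ c p a s ⟩
    a * p * (c * s)        ≤⟨ *-monoʳ-≤ (a * p) cs≤eN ⟩
    a * p * (e * N)        ≡⟨ r₂ a p e N ⟩
    a * e * (p * N)        ≤⟨ *-monoʳ-≤ (a * e) pN≤qU ⟩
    a * e * (q * U)        ≡⟨ sym (*-assoc (a * e) q U) ⟩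
    a * e * q * U          ≤⟨ *-monoˡ-≤ U aeq≤bcp ⟩
    b * c * p * U          ≡⟨ r₃ b c p U ⟩
    c * p * (b * U)        ∎)
    where
    open ≤-Reasoning
    r₁ : ∀ c p a s → c * p * (a * s) ≡ a * p * (c * s)
    r₁ = solve-∀
    r₂ : ∀ a p e N → a * p * (e * N) ≡ a * e * (p * N)
    r₂ = solve-∀
    r₃ : ∀ b c p U → b * c * p * U ≡ c * p * (b * U)
    r₃ = solve-∀

  -- For c = 100 and m = 55 this is 0.02 + 0.02 + 0.01 + 0.55 · 0.98². The factors 1 have the shape
  -- produced by clearing denominators.
  block-density : ∀ c m {s x y β w n} → s ≤ x * n + (n * y + (n * β + w)) →
    x * (c * 1) ≤ 2 * n → y * (c * 1) ≤ 2 * n → c * β ≤ n →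
    w * (c * (c * 1 * (c * 1 * 1))) ≤ m * (98 * n * (98 * n * 1)) →
    c * c * c * s ≤ (5 * (c * c) + m * (98 * 98)) * (n * n)
  block-density c m {s} {x} {y} {β} {w} {n} s≤ x≤ y≤ β≤ w≤ = begin
    c * c * c * s                                                     ≤⟨ *-monoʳ-≤ (c * c * c) s≤ ⟩
    c * c * c * (x * n + (n * y + (n * β + w)))                       ≡⟨ expand c x y β w n ⟩
    c * c * n * (x * (c * 1) + y * (c * 1) + c * β) + w * (c * (c * 1 * (c * 1 * 1)))
      ≤⟨ +-mono-≤ (*-monoʳ-≤ (c * c * n) (+-mono-≤ (+-mono-≤ x≤ y≤) β≤)) w≤ ⟩
    c * c * n * (2 * n + 2 * n + n) + m * (98 * n * (98 * n * 1))     ≡⟨ collect c m n 98 ⟩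
    (5 * (c * c) + m * (98 * 98)) * (n * n)                           ∎
    where
    open ≤-Reasoning
    expand : ∀ c x y β w n → c * c * c * (x * n + (n * y + (n * β + w))) ≡
             c * c * n * (x * (c * 1) + y * (c * 1) + c * β) + w * (c * (c * 1 * (c * 1 * 1)))
    expand = solve-∀
    collect : ∀ c m n h → c * c * n * (2 * n + 2 * n + n) + m * (h * n * (h * n * 1)) ≡
              (5 * (c * c) + m * (h * h)) * (n * n)
    collect = solve-∀

  part-size : ∀ c {y F G n} .{{_ : NonZero G}} → c * F ≤ G → y * (G * 1) ≤ F * n → c * y ≤ n
  part-size c {y} {F} {G} {n} cF≤G yG≤Fn = *-cancelˡ-≤ G (begin
    G * (c * y)          ≡⟨ rearrange G c y ⟩
    c * (y * (G * 1))    ≤⟨ *-monoʳ-≤ c yG≤Fn ⟩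
    c * (F * n)          ≡⟨ sym (*-assoc c F n) ⟩
    c * F * n            ≤⟨ *-monoˡ-≤ n cF≤G ⟩
    G * n                ∎)
    where
    open ≤-Reasoning
    rearrange : ∀ G c y → G * (c * y) ≡ c * (y * (G * 1))
    rearrange = solve-∀

open import Defs
open import Data.Integer as ℤ using (+_)
import Data.Integer.Properties as ℤ
open import Data.Rational using (ℚ; 1ℚ; mkℚ; _<_; _>_; _≤_; _≥_; _*_; _÷_; _/_; floor; toℚᵘ; NonNegative; *<*)
open import Data.Rational.Properties
open import Data.Rational.Unnormalised as ℚᵘ using (mkℚᵘ; *≤*; *≡*)
import Data.Rational.Unnormalised.Properties as ℚᵘ

-- Clearing denominators of rationals

toℚᵘ-/ : ∀ p q → toℚᵘ (+ p / suc q) ℚᵘ.≃ mkℚᵘ (+ p) q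
toℚᵘ-/ p q = toℚᵘ-fromℚᵘ (mkℚᵘ (+ p) q)

fromℕ-* : ∀ a b → fromℕ (a ℕ.* b) ≡ fromℕ a * fromℕ b
fromℕ-* a b = toℚᵘ-injective (begin-equality
  toℚᵘ (fromℕ (a ℕ.* b))                   ≃⟨ toℚᵘ-/ (a ℕ.* b) 0 ⟩
  mkℚᵘ (+ (a ℕ.* b)) 0                     ≃⟨ *≡* (cong (ℤ._* + 1) (ℤ.pos-* a b)) ⟩
  mkℚᵘ (+ a) 0 ℚᵘ.* mkℚᵘ (+ b) 0           ≃⟨ ℚᵘ.*-cong (toℚᵘ-/ a 0) (toℚᵘ-/ b 0) ⟨
  toℚᵘ (fromℕ a) ℚᵘ.* toℚᵘ (fromℕ b)       ≃⟨ toℚᵘ-homo-* (fromℕ a) (fromℕ b) ⟨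
  toℚᵘ (fromℕ a * fromℕ b)                 ∎)
  where open ℚᵘ.≤-Reasoning

fromℕ-cancel-≤ : ∀ {a b} → fromℕ a ≤ fromℕ b → a ℕ.≤ b
fromℕ-cancel-≤ {a} {b} a≤b
  with *≤* a*1≤b*1 ← ℚᵘ.≤-respˡ-≃ (toℚᵘ-/ a 0) (ℚᵘ.≤-respʳ-≃ (toℚᵘ-/ b 0) (toℚᵘ-mono-≤ a≤b))
  = ℤ.drop‿+≤+ (subst₂ ℤ._≤_ (ℤ.*-identityʳ (+ a)) (ℤ.*-identityʳ (+ b)) a*1≤b*1)

fromℕ-nonNeg : ∀ a → NonNegative (fromℕ a)
fromℕ-nonNeg a = normalize-nonNeg a 1

∣floor∣≤ : ∀ r .{{_ : NonNegative r}} → fromℕ ℤ.∣ floor r ∣ ≤ r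
∣floor∣≤ (mkℚ (+ a) d-1 _) = toℚᵘ-cancel-≤ (ℚᵘ.≤-respˡ-≃ (ℚᵘ.≃-sym (toℚᵘ-/ ℤ.∣ + 1 ℤ.* + (a ℕ./ suc d-1) ∣ 0)) (*≤* (begin
  + ℤ.∣ + 1 ℤ.* + q ∣ ℤ.* + suc d-1    ≡⟨ cong (λ i → + ℤ.∣ i ∣ ℤ.* + suc d-1) (ℤ.*-identityˡ (+ q)) ⟩
  + q ℤ.* + suc d-1                    ≡⟨ ℤ.pos-* q (suc d-1) ⟨
  + (q ℕ.* suc d-1)                    ≤⟨ ℤ.+≤+ (ℕ.m/n*n≤m a (suc d-1)) ⟩
  + a                                  ≡⟨ ℤ.*-identityʳ (+ a) ⟨
  + a ℤ.* + 1                          ∎)))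
  where
  open ℤ.≤-Reasoning
  q = a ℕ./ suc d-1

-- `p` and `q` need not be coprime, so products and powers are formed factor by factor without
-- normalisation, and large powers are never evaluated.
record IsFraction (r : ℚ) (p q : ℕ) : Set where
  constructor cleared
  field clear : r * fromℕ q ≡ fromℕ p

/-isFraction : ∀ p q .{{_ : ℕ.NonZero q}} → IsFraction (+ p / q) p q
/-isFraction p (suc q) = cleared (toℚᵘ-injective (begin-equality
  toℚᵘ (+ p / suc q * fromℕ (suc q))                   ≃⟨ toℚᵘ-homo-* (+ p / suc q) (fromℕ (suc q)) ⟩
  toℚᵘ (+ p / suc q) ℚᵘ.* toℚᵘ (fromℕ (suc q))         ≃⟨ ℚᵘ.*-cong (toℚᵘ-/ p q) (toℚᵘ-/ (suc q) 0) ⟩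
  mkℚᵘ (+ p) q ℚᵘ.* mkℚᵘ (+ suc q) 0                   ≃⟨ *≡* (trans (ℤ.*-identityʳ _) (cong (λ s → + p ℤ.* + suc s) (sym (ℕ.*-identityʳ q)))) ⟩
  mkℚᵘ (+ p) 0                                         ≃⟨ toℚᵘ-/ p 0 ⟨
  toℚᵘ (fromℕ p)                                       ∎))
  where open ℚᵘ.≤-Reasoning

fromℕ-isFraction : ∀ n → IsFraction (fromℕ n) n 1
fromℕ-isFraction n = /-isFraction n 1

*-isFraction : ∀ {r s p q p′ q′} → IsFraction r p q → IsFraction s p′ q′ → IsFraction (r * s) (p ℕ.* p′) (q ℕ.* q′)
*-isFraction {r} {s} {p} {q} {p′} {q′} (cleared rq≡p) (cleared sq′≡p′) = cleared (begin
  r * s * fromℕ (q ℕ.* q′)            ≡⟨ cong (r * s *_) (fromℕ-* q q′) ⟩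
  r * s * (fromℕ q * fromℕ q′)        ≡⟨ *-assoc r s _ ⟩
  r * (s * (fromℕ q * fromℕ q′))      ≡⟨ cong (r *_) (sym (*-assoc s (fromℕ q) _)) ⟩
  r * (s * fromℕ q * fromℕ q′)        ≡⟨ cong (λ t → r * (t * fromℕ q′)) (*-comm s (fromℕ q)) ⟩
  r * (fromℕ q * s * fromℕ q′)        ≡⟨ cong (r *_) (*-assoc (fromℕ q) s _) ⟩
  r * (fromℕ q * (s * fromℕ q′))      ≡⟨ sym (*-assoc r (fromℕ q) _) ⟩
  r * fromℕ q * (s * fromℕ q′)        ≡⟨ cong₂ _*_ rq≡p sq′≡p′ ⟩
  fromℕ p * fromℕ p′                  ≡⟨ sym (fromℕ-* p p′) ⟩
  fromℕ (p ℕ.* p′)                    ∎)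
  where open ≡-Reasoning

^-isFraction : ∀ {r p q} → IsFraction r p q → ∀ n → IsFraction (r ^ n) (p ℕ.^ n) (q ℕ.^ n)
^-isFraction f zero    = cleared refl
^-isFraction f (suc n) = *-isFraction f (^-isFraction f n)

≤-clear : ∀ a {r p q} → IsFraction r p q → fromℕ a ≤ r → a ℕ.* q ℕ.≤ p
≤-clear a {q = q} (cleared rq≡p) a≤r =
  fromℕ-cancel-≤ (subst₂ _≤_ (sym (fromℕ-* a q)) rq≡p (*-monoʳ-≤-nonNeg (fromℕ q) {{fromℕ-nonNeg q}} a≤r))

≥-clear : ∀ a {r p q} → IsFraction r p q → r ≤ fromℕ a → p ℕ.≤ a ℕ.* q
≥-clear a {q = q} (cleared rq≡p) r≤a =
  fromℕ-cancel-≤ (subst₂ _≤_ rq≡p (sym (fromℕ-* a q)) (*-monoʳ-≤-nonNeg (fromℕ q) {{fromℕ-nonNeg q}} r≤a))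

^-nonNeg : ∀ r .{{_ : NonNegative r}} n → NonNegative (r ^ n)
^-nonNeg r zero    = _
^-nonNeg r (suc n) = nonNeg*nonNeg⇒nonNeg r (r ^ n) {{^-nonNeg r n}}

-- By bernoulli⁻, c₀ ^ 160000 ≤ 10 / 9; and c₁ / c₀ = 1 - 1 / 3200000.
c₀ c₁ : ℚ
c₀ = + 1600000 / 1599999
c₁ = + 3199999 / 3199998

c₁<c₀ : c₁ < c₀
c₁<c₀ = *<* (ℤ.+<+ (ℕ.≤ᵇ⇒≤ _ _ _))

1<c₁ : 1ℚ < c₁
1<c₁ = *<* (ℤ.+<+ (ℕ.≤ᵇ⇒≤ _ _ _))

c₁÷c₀ : ℚ
c₁÷c₀ = (c₁ ÷ c₀) {{nonZero 1<c₁ c₁<c₀}}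

c₀-isFraction : IsFraction c₀ 1600000 1599999
c₀-isFraction = cleared refl

-- `c₀` is 3200000/3199998, with the same denominator as `c₁`.
c₁÷c₀-isFraction : IsFraction c₁÷c₀ 3199999 3200000
c₁÷c₀-isFraction = cleared refl

-- 40000 · 128 · 19998, so that d = ⌊Δ / 40000⌋ satisfies 128 · 19998ᵈ < 19999ᵈ.
Δ₀ : ℕ
Δ₀ = 102389760000

-- Verification of the two items

module _ (Δ n : ℕ) (Δ≥Δ₀ : Δ ℕ.≥ Δ₀) (n≥ : fromℕ n ≥ c₀ ^ (2 ℕ.* Δ)) where

  open Combinatorics

  private
    k d u : ℕ
    k = ℤ.∣ floor (c₀ ^ Δ) ∣
    d = Δ ℕ./ 40000
    u = n ℕ.∸ n ℕ./ 40000

    k*p^Δ≤ : k ℕ.* 1599999 ℕ.^ Δ ℕ.≤ 1600000 ℕ.^ Δ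
    k*p^Δ≤ = ≤-clear k (^-isFraction c₀-isFraction Δ) (∣floor∣≤ (c₀ ^ Δ) {{^-nonNeg c₀ Δ}})

    ≤n*p^2Δ : 1600000 ℕ.^ (2 ℕ.* Δ) ℕ.≤ n ℕ.* 1599999 ℕ.^ (2 ℕ.* Δ)
    ≤n*p^2Δ = ≥-clear n (^-isFraction c₀-isFraction (2 ℕ.* Δ)) n≥

    instance
      n≢0 : ℕ.NonZero n
      n≢0 = ℕ.≢-nonZero λ n≡0 → ℕ.<⇒≱ (ℕ.m^n>0 1600000 (2 ℕ.* Δ))
        (subst (λ m → 1600000 ℕ.^ (2 ℕ.* Δ) ℕ.≤ m ℕ.* 1599999 ℕ.^ (2 ℕ.* Δ)) n≡0 ≤n*p^2Δ)

      u≢0 : ℕ.NonZero u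
      u≢0 = ℕ.>-nonZero (ℕ.m<n⇒0<n∸m (ℕ.m/n<m n 40000 (ℕ.≤ᵇ⇒≤ 2 40000 _)))

      u*u≢0 : ℕ.NonZero (u ℕ.* u)
      u*u≢0 = ℕ.m*n≢0 u u

      Δ≢0 : ℕ.NonZero Δ
      Δ≢0 = ℕ.>-nonZero (ℕ.≤-trans (ℕ.≤ᵇ⇒≤ 1 Δ₀ _) Δ≥Δ₀)

    d≥ : 128 ℕ.* 19998 ℕ.≤ d
    d≥ = ℕ./-monoˡ-≤ 40000 Δ≥Δ₀

    robust : _
    -- 19998/19999 = (9999/10000) · (20000/19999) bounds the density of the complement of a
    -- rectangle among the `u * u` available pairs.
    robust = robust-graph n k Δ d u 19998 19999
      (λ w → n∸n/b≤w n Δ 40000 d w (ℕ.≤-trans (ℕ.≤-reflexive (ℕ.*-comm 40000 d)) (ℕ.m/n*n≤m Δ 40000)))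
      (k*k≤n 1599999 k n Δ k*p^Δ≤ ≤n*p^2Δ)
      -- 160000 is both a tenth of 1600000 and 4 · 40000, so 2Δ ≤ 160000d in spite of the rounding
      -- in `d`.
      (k*k*9^d≤10^d 1599999 160000 k Δ d refl (2*m≤4*b*[m/b] Δ 40000 (ℕ.≤-trans (ℕ.≤ᵇ⇒≤ 40000 Δ₀ _) Δ≥Δ₀)) k*p^Δ≤)
      (*-^-<-suc-^ 128 19998 d d≥)

    H : BipartiteGraph n
    H = proj₁ robust

    available : 19999 ℕ.* (n ℕ.* n) ℕ.≤ 20000 ℕ.* (u ℕ.* u)
    -- 39999² = 80000 · 19999 + 1 and 40000² = 80000 · 20000.
    available = square-ratio {39999} {40000} {n} {u} 80000 19999 20000 ([b∸1]*n≤b*[n∸n/b] n 40000) (ℕ.≤ᵇ⇒≤ _ _ _) refl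

  lemma3p2-graph :
    let bound = c₁÷c₀ ^ Δ * fromℕ n in
    Σ[ H ∈ BipartiteGraph n ]
      (BipartiteGraph.MaxDegree≤ H Δ
      × ((P Q : Partition n k) →
          (∀ i → fromℕ ∣ Partition.part P i ∣ ≤ bound) →
          (∀ i → fromℕ ∣ Partition.part Q i ∣ ≤ bound) →
          fromℕ ∣ Partition.rest P ∣ ≤ (+ 2 / 100) * fromℕ n →
          fromℕ ∣ Partition.rest Q ∣ ≤ (+ 2 / 100) * fromℕ n →
          fromℕ (offDiagonalWeight H P Q)
            > (+ 55 / 100) * ((+ 98 / 100) * fromℕ n) ^ 2)
      × ((X′ Y′ : Subset n) →
          fromℕ ∣ X′ ∣ ≥ (+ 1 / 100) * fromℕ n →
          fromℕ ∣ Y′ ∣ ≥ (+ 1 / 100) * fromℕ n →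
          BipartiteGraph.e H X′ Y′ ℕ.> 0))
  lemma3p2-graph = H , proj₁ (proj₂ robust) , weight , dense
    where
    2%n : IsFraction ((+ 2 / 100) * fromℕ n) (2 ℕ.* n) (100 ℕ.* 1)
    2%n = *-isFraction (/-isFraction 2 100) (fromℕ-isFraction n)

    weight : (P Q : Partition n k) → _ → _ → _ → _ → _
    weight P Q _ Q≤ restP≤ restQ≤ = ≰⇒> λ W≤ →
      let small = block-density 100 55
                    {x = ∣ Partition.rest P ∣} {∣ Partition.rest Q ∣} {n ℕ./ 100} {offDiagonalWeight H P Q}
                    (∣blockSet∣≤ H P Q (n ℕ./ 100) Y≤)
                    (≤-clear ∣ Partition.rest P ∣ 2%n restP≤) (≤-clear ∣ Partition.rest Q ∣ 2%n restQ≤)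
                    (ℕ.≤-trans (ℕ.≤-reflexive (ℕ.*-comm 100 (n ℕ./ 100))) (ℕ.m/n*n≤m n 100))
                    (≤-clear (offDiagonalWeight H P Q) (*-isFraction (/-isFraction 55 100)
                      (^-isFraction (*-isFraction (/-isFraction 98 100) (fromℕ-isFraction n)) 2)) W≤)
          x , y , xy , xy∉ = proj₁ (proj₂ (proj₂ robust)) (blocks H P Q)
            (scale {∣ blockSet (blocks H P Q) ∣ₑ} {n ℕ.* n} {u ℕ.* u}
              -- 578220 = 5 · 100² + 55 · 98², so the density 0.57822 lies well below the required
              -- 9/10 · 19998/19999.
              (10 ℕ.* 19999) (9 ℕ.* 19998) 1000000 578220 19999 20000 (ℕ.≤ᵇ⇒≤ _ _ _) available small)
      in contradiction (trans (sym (edges⊆blockSet H P Q x y xy)) xy∉) λ ()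
      where
      open Partition Q using () renaming (part to Y)
      Y≤ : ∀ j → ∣ Y j ∣ ℕ.≤ n ℕ./ 100
      Y≤ j = subst (ℕ._≤ n ℕ./ 100) (ℕ.m*n/n≡m ∣ Y j ∣ 100) (ℕ./-monoˡ-≤ 100
        (subst (ℕ._≤ n) (ℕ.*-comm 100 ∣ Y j ∣) (part-size 100
          {∣ Y j ∣} {3199999 ℕ.^ Δ} {3200000 ℕ.^ Δ} {n} {{ℕ.m^n≢0 3200000 Δ}}
          (ℕ.<⇒≤ (*-^-<-suc-^ 100 3199999 Δ (ℕ.≤-trans (ℕ.≤ᵇ⇒≤ (100 ℕ.* 3199999) Δ₀ _) Δ≥Δ₀)))
          (≤-clear ∣ Y j ∣ (*-isFraction (^-isFraction c₁÷c₀-isFraction Δ) (fromℕ-isFraction n)) (Q≤ j)))))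

    dense : (X′ Y′ : Subset n) → _ → _ → _
    dense X′ Y′ X′≥ Y′≥ = proj₂ (proj₂ (proj₂ robust)) X′ Y′
      (scale {∣ rectangleComplement (X′ , Y′) ∣ₑ} {n ℕ.* n} {u ℕ.* u}
        -- The inequality of constants is an equality here: 9999 · 20000 = 19998 · 10000.
        19999 19998 10000 9999 19999 20000 (ℕ.≤ᵇ⇒≤ _ _ _) available
        (∣rectangleComplement∣≤ 100 9999 X′ Y′ refl (n≤100* X′ X′≥) (n≤100* Y′ Y′≥)))
      where
      n≤100* : (Z : Subset n) → fromℕ ∣ Z ∣ ≥ (+ 1 / 100) * fromℕ n → n ℕ.≤ 100 ℕ.* ∣ Z ∣
      n≤100* Z Z≥ = subst₂ ℕ._≤_ (ℕ.*-identityˡ n) (ℕ.*-comm ∣ Z ∣ 100)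
        (≥-clear ∣ Z ∣ (*-isFraction (/-isFraction 1 100) (fromℕ-isFraction n)) Z≥)

lemma3p2 :
    Σ[ c₀ ∈ ℚ ] Σ[ c₁ ∈ ℚ ] Σ[ c₁<c₀ ∈ c₁ < c₀ ] Σ[ 1<c₁ ∈ 1ℚ < c₁ ] Σ[ Δ₀ ∈ ℕ ]
      ((Δ n : ℕ) → Δ ℕ.≥ Δ₀ → fromℕ n ≥ c₀ ^ (2 ℕ.* Δ) →
        let k = ℤ.∣ floor (c₀ ^ Δ) ∣
            bound = ((c₁ ÷ c₀) {{nonZero 1<c₁ c₁<c₀}}) ^ Δ * fromℕ n
        in
        Σ[ H ∈ BipartiteGraph n ]
          (BipartiteGraph.MaxDegree≤ H Δ
          × ((P Q : Partition n k) →
              (∀ i → fromℕ ∣ Partition.part P i ∣ ≤ bound) →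
              (∀ i → fromℕ ∣ Partition.part Q i ∣ ≤ bound) →
              fromℕ ∣ Partition.rest P ∣ ≤ (+ 2 / 100) * fromℕ n →
              fromℕ ∣ Partition.rest Q ∣ ≤ (+ 2 / 100) * fromℕ n →
              fromℕ (offDiagonalWeight H P Q)
                > (+ 55 / 100) * ((+ 98 / 100) * fromℕ n) ^ 2)
          × ((X′ Y′ : Subset n) →
              fromℕ ∣ X′ ∣ ≥ (+ 1 / 100) * fromℕ n →
              fromℕ ∣ Y′ ∣ ≥ (+ 1 / 100) * fromℕ n →
              BipartiteGraph.e H X′ Y′ ℕ.> 0)))
lemma3p2 = c₀ , c₁ , c₁<c₀ , 1<c₁ , Δ₀ , lemma3p2-graph
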